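{- Let $T=(V,E)$ be a finite tree with at least one edge. Let $t\mapsto w(t)$ be a solution, with $w_e(t)>0$ for all $e\in E$, of either the unnormalized flow $\dot w_e=-\kappa_e(w)w_e$ $(e\in E)$, or the normalized flow $\dot w_e=-w_e(\kappa_e(w)-K(w))$ $(e\in E)$, $K(w)=\sum_{f\in E}w_f\kappa_f(w)$, with $\sum_{e}w_e(0)=1$. Then the curvature vector $\kappa(t)=(\kappa_e(w(t)))_{e\in E}$ satisfies $$\dot\kappa=-\mathcal L(w)\kappa .$$ Moreover, for each positive metric $w\in(0,\infty)^E$, the matrix $\mathcal L(w)$ is symmetric and positive semidefinite, $\mathcal L(w)\mathbf 1=0$, and for all $z\in\mathbb R^E$ $$\langle z,\mathcal L(w)z\rangle=\sum_{\{e,f\}:\,a_{ef}(w)>0}a_{ef}(w)(z_e-z_f)^2\ge 0 .$$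
   Context: $T=(V,E)$ is a finite tree with at least one edge; $d_x$ is the combinatorial degree of $x\in V$. A positive metric is $w=(w_e)_{e\in E}$ with all $w_e>0$; it induces the path metric $d_w$ on $V$. Put $D_x(w)=\sum_{e\ni x}1/w_e$. For $\alpha\in[0,1)$ let $m_x^\alpha(x)=\alpha$ and $m_x^\alpha(z)=(1-\alpha)\,w_{xz}^{ -1}/D_x(w)$ for $z\sim x$. The (inverse-weight) Lin--Lu--Yau curvature of $e=xy$ is $\kappa_e(w)=\lim_{\alpha\uparrow1}\frac{1-W_1(m_x^\alpha,m_y^\alpha)/w_e}{1-\alpha}$, with $W_1$ the $1$-Wasserstein distance for $d_w$. Known formula on trees: $\kappa_{xy}(w)=\frac{2-d_x}{w_{xy}D_x(w)}+\frac{2-d_y}{w_{xy}D_y(w)}$. For distinct edges $e,f$ sharing a (necessarily unique) vertex $x$, put $a_{ef}(w)=\frac{d_x-2}{D_x(w)^2w_ew_f}$ if $d_x\ge3$, and $a_{ef}(w)=0$ if $d_x\le2$; put $a_{ef}(w)=0$ if $e,f$ share no vertex. The matrix $\mathcal L(w)$, indexed by $E$, is defined by $(\mathcal L(w)z)_e=\sum_{f\ne e}a_{ef}(w)(z_e-z_f)$. $\mathbf 1$ is the all-one vector in $\mathbb R^E$, $\langle\cdot,\cdot\rangle$ is the Euclidean inner product, and a dot denotes $d/dt$. Sums over $\{e,f\}$ are over unordered pairs of distinct edges. -}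

module Defs where

open import Algebra.Bundles using (CommutativeRing)
open import Algebra.Core using (Op₁; Op₂)
open import Algebra.Structures using (IsCommutativeRing)
open import Data.Bool.Base using (if_then_else_; true; false)
open import Data.Fin.Base as Fin using (Fin; zero; suc)
import Data.Fin.Properties as Fin
open import Data.List.Base using (List; []; _∷_; length; filter; allFin)
open import Data.List.Relation.Unary.Unique.Propositional using (Unique)
open import Data.Nat.Base as ℕ using (ℕ; zero; suc)
import Data.Nat.Properties as ℕ
open import Data.Product.Base using (Σ-syntax; ∃-syntax; _×_; _,_)
open import Data.Sum.Base using (_⊎_)
open import Data.Vec.Functional using (Vector)
open import Level using (Level) renaming (suc to lsuc)
open import Relation.Binary.Core using (Rel)
open import Relation.Binary.Structures using (IsStrictTotalOrder)
open import Relation.Binary.PropositionalEquality.Core as ≡ using (_≡_)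
open import Relation.Nullary using (¬_; Dec; yes; no; does)
open import Relation.Nullary.Decidable using (¬?; _×-dec_; _⊎-dec_; map′)
open import Relation.Nullary.Negation using (contradiction)
open import Relation.Unary using (Pred)
import Relation.Binary.Construct.StrictToNonStrict as StrictToNonStrict

-- The classical axioms of the real numbers; up to isomorphism ℝ is the only
-- model.  The reciprocal and the supremum are total operations, constrained
-- only where they are mathematically meaningful (nonzero arguments, and
-- nonempty sets that are bounded above, respectively).

record CompleteOrderedField (ℓ : Level) : Set (lsuc ℓ) where
  infix  9 _⁻¹
  infix  8 -_
  infixl 7 _*_ _/_
  infixl 6 _+_
  infix  4 _≈_ _<_
  field
    Carrier            : Set ℓ
    _≈_                : Rel Carrier ℓ
    _<_                : Rel Carrier ℓ
    _+_                : Op₂ Carrier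
    _*_                : Op₂ Carrier
    -_                 : Op₁ Carrier
    _⁻¹                : Op₁ Carrier
    0#                 : Carrier
    1#                 : Carrier
    isCommutativeRing  : IsCommutativeRing _≈_ _+_ _*_ -_ 0# 1#
    ⁻¹-cong            : ∀ {x y} → x ≈ y → x ⁻¹ ≈ y ⁻¹
    *-inverseʳ         : ∀ x → ¬ (x ≈ 0#) → x * x ⁻¹ ≈ 1#
    isStrictTotalOrder : IsStrictTotalOrder _≈_ _<_
    0<1                : 0# < 1#
    +-monoʳ-<          : ∀ x {y z} → y < z → x + y < x + z
    *-positive         : ∀ {x y} → 0# < x → 0# < y → 0# < x * y

  open StrictToNonStrict _≈_ _<_ public using (_≤_)

  IsUpperBound : Pred Carrier ℓ → Carrier → Set ℓ
  IsUpperBound P b = ∀ {x} → P x → x ≤ b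

  field
    ⨆         : Pred Carrier ℓ → Carrier
    ⨆-upper   : ∀ {P} → ∃[ x ] P x → ∃[ b ] IsUpperBound P b →
                IsUpperBound P (⨆ P)
    ⨆-least   : ∀ {P} → ∃[ x ] P x → ∃[ b ] IsUpperBound P b →
                ∀ {b} → IsUpperBound P b → ⨆ P ≤ b

  commutativeRing : CommutativeRing ℓ ℓ
  commutativeRing = record { isCommutativeRing = isCommutativeRing }

  open CommutativeRing commutativeRing public
    using (_-_; setoid; semiring; ring; +-monoid)
  open IsStrictTotalOrder isStrictTotalOrder public
    using (compare; _≟_; _<?_)

  _/_ : Op₂ Carrier
  x / y = x * y ⁻¹

  fromℕ : ℕ → Carrier
  fromℕ n = n ·ℕ 1#
    where open import Algebra.Properties.Monoid.Mult +-monoid using () renaming (_×_ to _·ℕ_)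

  ⨅ : Pred Carrier ℓ → Carrier
  ⨅ P = - ⨆ (λ x → P (- x))

module Analysis {ℓ : Level} (ℝ : CompleteOrderedField ℓ) where
  open CompleteOrderedField ℝ

  infix 4 ∣_-_∣<_

  ∣_-_∣<_ : Carrier → Carrier → Carrier → Set ℓ
  ∣ x - y ∣< ε = (x - y < ε) × (y - x < ε)

  Tendsto↑1 : (Carrier → Carrier) → Carrier → Set ℓ
  Tendsto↑1 g r =
    ∀ ε → 0# < ε → ∃[ δ ] (0# < δ × (∀ α → 0# ≤ α → α < 1# → 1# - α < δ →
      ∣ g α - r ∣< ε))

  -- When the limit exists it is the only element of the set below, so it is
  -- also the supremum of that set.
  lim↑1 : (Carrier → Carrier) → Carrier
  lim↑1 g = ⨆ (Tendsto↑1 g)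

  -- Nondegenerate intervals, of any kind (open or closed at either end,
  -- bounded or not).
  record IsInterval (I : Pred Carrier ℓ) : Set ℓ where
    field
      convex        : ∀ {r s t} → I r → I t → r ≤ s → s ≤ t → I s
      nondegenerate : ∃[ s ] ∃[ t ] (I s × I t × s < t)

  -- g has derivative g′ at t, relative to I (hence one-sided at an endpoint
  -- belonging to I).
  HasDerivative : Pred Carrier ℓ → (Carrier → Carrier) → Carrier → Carrier → Set ℓ
  HasDerivative I g t g′ =
    ∀ ε → 0# < ε → ∃[ δ ] (0# < δ × (∀ s → I s → ¬ (s ≈ t) → ∣ s - t ∣< δ →
      ∣ (g s - g t) / (s - t) - g′ ∣< ε))

module LinearAlgebra {ℓ : Level} (ℝ : CompleteOrderedField ℓ) where
  open CompleteOrderedField ℝ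
  open import Algebra.Properties.Semiring.Sum semiring public
    using (sum; sum-syntax)

  Matrix : ℕ → Set ℓ
  Matrix n = Fin n → Fin n → Carrier

  infixr 7 _*ᵥ_

  _*ᵥ_ : ∀ {n} → Matrix n → Vector Carrier n → Vector Carrier n
  _*ᵥ_ {n} M z i = ∑[ j < n ] (M i j * z j)

  ⟨_,_⟩ : ∀ {n} → Vector Carrier n → Vector Carrier n → Carrier
  ⟨_,_⟩ {n} y z = ∑[ i < n ] (y i * z i)

  𝟏 : ∀ {n} → Vector Carrier n
  𝟏 _ = 1#

  Symmetric : ∀ {n} → Matrix n → Set ℓ
  Symmetric M = ∀ i j → M i j ≈ M j i

  PositiveSemidefinite : ∀ {n} → Matrix n → Set ℓ
  PositiveSemidefinite M = ∀ z → 0# ≤ ⟨ z , M *ᵥ z ⟩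

  -- For restricted sums: Σ over i with P i of g i is ∑[ i < n ] when (P? i) (g i).
  when : ∀ {p} {P : Set p} → Dec P → Carrier → Carrier
  when P? x = if does P? then x else 0#

-- Finite simple graphs.  An edge is a two-element set of vertices, encoded by
-- its endpoints in increasing order; this orientation carries no meaning.

record Graph : Set where
  field
    ∣V∣ ∣E∣   : ℕ
    lo hi     : Fin ∣E∣ → Fin ∣V∣
    lo<hi     : ∀ e → lo e Fin.< hi e
    injective : ∀ {e f} → lo e ≡ lo f → hi e ≡ hi f → e ≡ f

  Vertex Edge : Set
  Vertex = Fin ∣V∣
  Edge   = Fin ∣E∣

  infix 4 _∈ₑ_ _∈ₑ?_

  _∈ₑ_ : Vertex → Edge → Set
  x ∈ₑ e = x ≡ lo e ⊎ x ≡ hi e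

  _∈ₑ?_ : ∀ x e → Dec (x ∈ₑ e)
  x ∈ₑ? e = (x Fin.≟ lo e) ⊎-dec (x Fin.≟ hi e)

  Joins : Edge → Vertex → Vertex → Set
  Joins e x y = (lo e ≡ x × hi e ≡ y) ⊎ (lo e ≡ y × hi e ≡ x)

  Adjacent : Vertex → Vertex → Set
  Adjacent x y = ∃[ e ] Joins e x y

  adjacent? : ∀ x y → Dec (Adjacent x y)
  adjacent? x y = Fin.any? λ e →
    ((lo e Fin.≟ x) ×-dec (hi e Fin.≟ y)) ⊎-dec ((lo e Fin.≟ y) ×-dec (hi e Fin.≟ x))

  ShareVertex : Edge → Edge → Set
  ShareVertex e f = ∃[ x ] (x ∈ₑ e × x ∈ₑ f)

  shareVertex? : ∀ e f → Dec (ShareVertex e f)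
  shareVertex? e f = Fin.any? λ x → (x ∈ₑ? e) ×-dec (x ∈ₑ? f)

  degree : Vertex → ℕ
  degree x = length (filter (x ∈ₑ?_) (allFin ∣E∣))

  data Walk : Vertex → Vertex → Set where
    []   : ∀ {x} → Walk x x
    step : ∀ {x y z} (e : Edge) → Joins e x y → Walk y z → Walk x z

  vertices : ∀ {x y} → Walk x y → List Vertex
  vertices {x} []           = x ∷ []
  vertices {x} (step _ _ p) = x ∷ vertices p

  steps : ∀ {x y} → Walk x y → ℕ
  steps []           = 0
  steps (step _ _ p) = suc (steps p)

  IsPath : ∀ {x y} → Walk x y → Set
  IsPath p = Unique (vertices p)

  Connected : Set
  Connected = ∀ x y → Walk x y

  -- A cycle is a path with at least three vertices together with an edge
  -- joining its ends.
  Acyclic : Set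
  Acyclic = ∀ {x y} (p : Walk x y) → IsPath p → 2 ℕ.≤ steps p → ¬ Adjacent y x

record Tree : Set where
  field
    graph     : Graph
    connected : Graph.Connected graph
    acyclic   : Graph.Acyclic graph
  open Graph graph public

module Curvature {ℓ : Level} (ℝ : CompleteOrderedField ℓ) (T : Tree) where
  open CompleteOrderedField ℝ
  open Analysis ℝ
  open LinearAlgebra ℝ
  open Tree T

  Weight : Set ℓ
  Weight = Vector Carrier ∣E∣

  Positive : Weight → Set ℓ
  Positive w = ∀ e → 0# < w e

  walkLength : Weight → ∀ {x y} → Walk x y → Carrier
  walkLength w []           = 0#
  walkLength w (step e _ p) = w e + walkLength w p

  pathMetric : Weight → Vertex → Vertex → Carrier
  pathMetric w x y = ⨅ λ r → Σ[ p ∈ Walk x y ] walkLength w p ≈ r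

  record IsCoupling (μ ν : Vector Carrier ∣V∣)
                    (π : Vertex → Vertex → Carrier) : Set ℓ where
    field
      nonneg     : ∀ x y → 0# ≤ π x y
      marginalˡ  : ∀ x → ∑[ y < ∣V∣ ] π x y ≈ μ x
      marginalʳ  : ∀ y → ∑[ x < ∣V∣ ] π x y ≈ ν y

  cost : Weight → (Vertex → Vertex → Carrier) → Carrier
  cost w π = ∑[ x < ∣V∣ ] ∑[ y < ∣V∣ ] (π x y * pathMetric w x y)

  W₁ : Weight → Vector Carrier ∣V∣ → Vector Carrier ∣V∣ → Carrier
  W₁ w μ ν = ⨅ λ r → ∃[ π ] (IsCoupling μ ν π × cost w π ≈ r)

  D : Weight → Vertex → Carrier
  D w x = ∑[ e < ∣E∣ ] when (x ∈ₑ? e) (w e ⁻¹)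

  neighbourMass : Weight → Carrier → ∀ x {z} → Dec (Adjacent x z) → Carrier
  neighbourMass w α x (yes (e , _)) = (1# - α) * (w e ⁻¹ / D w x)
  neighbourMass w α x (no _)        = 0#

  m : Weight → Carrier → Vertex → Vector Carrier ∣V∣
  m w α x z = if does (x Fin.≟ z) then α else neighbourMass w α x (adjacent? x z)

  κ : Weight → Edge → Carrier
  κ w e = lim↑1 λ α → (1# - W₁ w (m w α (lo e)) (m w α (hi e)) / w e) / (1# - α)

  -- Only used for distinct e and f, which share at most one vertex.
  a : Weight → Edge → Edge → Carrier
  a w e f with shareVertex? e f
  ... | no _        = 0#
  ... | yes (x , _) =
    if does (3 ℕ.≤? degree x)
    then (fromℕ (degree x) - fromℕ 2) / (D w x * D w x * w e * w f)
    else 0#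

  ∑≢ : Edge → (Edge → Carrier) → Carrier
  ∑≢ e g = ∑[ f < ∣E∣ ] when (¬? (f Fin.≟ e)) (g f)

  -- The entries are those of the operator z ↦ (Σ_{f≠e} a_ef (z_e - z_f))_e;
  -- see 𝓛-action.
  𝓛 : Weight → Matrix ∣E∣
  𝓛 w e f = if does (f Fin.≟ e) then ∑≢ e (a w e) else - a w e f

  -- The sum over unordered pairs {e,f} of distinct edges with a_ef > 0.
  dirichletForm : Weight → Vector Carrier ∣E∣ → Carrier
  dirichletForm w z =
    ∑[ e < ∣E∣ ] ∑[ f < ∣E∣ ] when ((e Fin.<? f) ×-dec (0# <? a w e f))
      (a w e f * ((z e - z f) * (z e - z f)))

  K : Weight → Carrier
  K w = ∑[ f < ∣E∣ ] (w f * κ w f)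

  record IsPositiveSolution (F : Weight → Edge → Carrier) (I : Pred Carrier ℓ)
                            (w : Carrier → Weight) : Set ℓ where
    field
      cong     : ∀ {s t} → s ≈ t → ∀ e → w s e ≈ w t e
      positive : ∀ t → I t → Positive (w t)
      solves   : ∀ t → I t → ∀ e → HasDerivative I (λ s → w s e) t (F (w t) e)

  UnnormalizedFlow : Pred Carrier ℓ → (Carrier → Weight) → Set ℓ
  UnnormalizedFlow = IsPositiveSolution λ w e → - κ w e * w e

  NormalizedFlow : Pred Carrier ℓ → (Carrier → Weight) → Set ℓ
  NormalizedFlow I w =
    IsPositiveSolution (λ w e → - (w e * (κ w e - K w))) I w ×
    I 0# × ∑[ e < ∣E∣ ] w 0# e ≈ 1#

  private
    open CommutativeRing commutativeRing
      using (refl; sym; trans; +-cong; +-congˡ; +-identityˡ; +-identityʳ;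
             *-congʳ; distribˡ; zeroˡ)
    open import Algebra.Properties.Ring ring using (-‿distribˡ-*; -‿distribʳ-*)
    open import Algebra.Properties.Semiring.Sum semiring
      using (sum-cong-≋; sum-replicate-zero; ∑-distrib-+; *-distribʳ-sum)
    open import Relation.Binary.Reasoning.Setoid setoid

    ∑-single : ∀ {n} (i : Fin n) (g : Fin n → Carrier) →
               ∑[ j < n ] when (j Fin.≟ i) (g j) ≈ g i
    ∑-single {suc n} zero    g = trans (+-congˡ (sum-replicate-zero n)) (+-identityʳ _)
    ∑-single {suc n} (suc i) g = trans (+-identityˡ _) (∑-single i (λ j → g (suc j)))

  𝓛-action : ∀ w z e → (𝓛 w *ᵥ z) e ≈ ∑≢ e (λ f → a w e f * (z e - z f))
  𝓛-action w z e = begin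
    (𝓛 w *ᵥ z) e                                 ≈⟨ sum-cong-≋ split ⟩
    ∑[ f < ∣E∣ ] (diag f + off f)                 ≈⟨ ∑-distrib-+ diag off ⟩
    ∑[ f < ∣E∣ ] diag f + ∑[ f < ∣E∣ ] off f       ≈⟨ +-cong (∑-single e (λ f → S * z f)) refl ⟩
    S * z e + ∑[ f < ∣E∣ ] off f                  ≈⟨ +-cong (*-distribʳ-sum (z e) on) refl ⟩
    ∑[ f < ∣E∣ ] (on f * z e) + ∑[ f < ∣E∣ ] off f ≈⟨ ∑-distrib-+ (λ f → on f * z e) off ⟨
    ∑[ f < ∣E∣ ] (on f * z e + off f)             ≈⟨ sum-cong-≋ merge ⟩
    ∑≢ e (λ f → a w e f * (z e - z f))            ∎
    where
    S = ∑≢ e (a w e)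
    diag off on : Edge → Carrier
    diag f = when (f Fin.≟ e) (S * z f)
    off f  = when (¬? (f Fin.≟ e)) (- a w e f * z f)
    on f   = when (¬? (f Fin.≟ e)) (a w e f)

    split : ∀ f → 𝓛 w e f * z f ≈ diag f + off f
    split f with does (f Fin.≟ e)
    ... | true  = sym (+-identityʳ _)
    ... | false = sym (+-identityˡ _)

    merge : ∀ f → on f * z e + off f ≈ when (¬? (f Fin.≟ e)) (a w e f * (z e - z f))
    merge f with does (f Fin.≟ e)
    ... | true  = trans (+-identityʳ _) (zeroˡ _)
    ... | false = begin
      a w e f * z e + - a w e f * z f      ≈⟨ +-congˡ (trans (sym (-‿distribˡ-* _ _)) (-‿distribʳ-* _ _)) ⟩
      a w e f * z e + a w e f * (- z f)    ≈⟨ distribˡ _ _ _ ⟨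
      a w e f * (z e - z f)                ∎

{-# OPTIONS --safe #-}

-- On a tree every antisymmetric 1-form θ is the differential of a potential,
-- because erasing loops reduces a closed walk to the empty one without changing
-- the integral of θ.  For an edge e = xy, direct the edges meeting e along the
-- transport from x to y: the resulting potential Φ is 1-Lipschitz, and for
-- α ≥ 1/2 it is calibrated by the coupling that moves all that has left x to y,
-- all that is to surround y out of x, and the remaining mass from x to y.  Hence
--   W₁ = w_e + (1 - α) ((d_x - 2) / D_x + (d_y - 2) / D_y)   for 1/2 ≤ α < 1,
-- which gives κ_e explicitly as a function of the numbers u_e = 1 / w_e.
--
-- Both flows read u̇_e = (κ_e - c) u_e, with c = 0 or c = K(w).  Since
-- D_x = Σ_{g ∋ x} u_g, the constant c cancels in
--   d/dt (u_e / D_x) = u_e / D_x² · Σ_{g ∋ x} u_g (κ_e - κ_g),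
-- and summing over the two ends of e yields -(𝓛 κ)_e.

module Submission where

-- The curvature is a limit of optimal costs for a metric that is itself an infimum, and none of
-- these extremal quantities is solved in general. The metric is evaluated only on pairs charged by
-- one coupling, `W₁` only by matching that coupling with one potential, and the limit only for a
-- quotient that is constant from α = 1/2 on. The tree makes the potential cheap: edge increments
-- may be prescribed freely, the transport forces their signs on the edges meeting e, and elsewhere
-- any sign will do.
--
-- The delicate point of the last step is the sign of d_x - 2. The curvature formula holds at leaves
-- too, where this number is -1, whereas a_ef is set to 0 for d_x ≤ 2. The two agree: at degree 2
-- the factor vanishes, and at a leaf the only edge is e, whose term κ_e - κ_e is 0.

open import Defs
open import Algebra.Bundles using (CommutativeRing; RawRing)
import Algebra.Solver.Ring as RingSolver
open import Algebra.Solver.Ring.AlmostCommutativeRing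
  using (fromCommutativeRing; _-Raw-AlmostCommutative⟶_)
open import Data.Bool.Base using (if_then_else_; true; false)
open import Data.Fin.Base as Fin using (Fin; zero; suc)
import Data.Fin.Properties as Fin
open import Data.Integer.Base as ℤ using (ℤ; +_; -[1+_])
import Data.Integer.Properties as ℤ
open import Data.List.Base using (List; []; _∷_; length; filter; tabulate)
open import Data.List.Membership.Propositional using (_∈_)
open import Data.List.Membership.Propositional.Properties using (∈-filter⁺; ∈-allFin)
open import Data.List.Relation.Unary.All as All using ([]; _∷_)
open import Data.List.Relation.Unary.All.Properties using (¬Any⇒All¬)
open import Data.List.Relation.Unary.AllPairs using ([]; _∷_)
open import Data.List.Relation.Unary.Any using (here; there)
open import Data.Maybe.Base as Maybe using (Maybe)
open import Data.Nat.Base as ℕ using (ℕ; zero; suc; z≤n; s≤s; NonZero)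
import Data.Nat.Properties as ℕ
open import Data.Product.Base using (Σ-syntax; ∃-syntax; _×_; _,_; proj₁; proj₂)
open import Data.Sum.Base using (_⊎_; inj₁; inj₂)
open import Data.Vec.Functional using (Vector)
open import Function.Base using (_∘_; id)
open import Level using (Level)
import Relation.Binary.Construct.StrictToNonStrict as StrictToNonStrict
open import Relation.Binary.Definitions using (tri<; tri≈; tri>)
open import Relation.Binary.PropositionalEquality.Core as ≡ using (_≡_; _≢_)
open import Relation.Binary.Structures using (IsStrictTotalOrder)
open import Relation.Nullary using (¬_; Dec; yes; no; does)
open import Relation.Nullary.Decidable using (dec⇒maybe; ¬?; _×-dec_; _⊎-dec_)
open import Relation.Nullary.Negation using (contradiction)
open import Relation.Unary using (Pred; Decidable)

-- The ring solver with integer coefficients: over an abstract ring it has to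
-- recognise that numerals such as 1 - 1 vanish.
module IntegerCoefficients {c ℓ} (R : CommutativeRing c ℓ) where
  open CommutativeRing R
  open import Algebra.Properties.Semiring.Mult.TCOptimised semiring
    using (×-homo-+; ×1-homo-*; 1+×) renaming (_×_ to _·_)
  open import Algebra.Properties.Ring ring
    using (-‿distribˡ-*; -‿distribʳ-*; -‿involutive; -0#≈0#)
  open import Algebra.Properties.AbelianGroup +-abelianGroup using (⁻¹-∙-comm)
  open import Relation.Binary.Reasoning.Setoid setoid

  -- With the optimised multiple, `1 · 1#` computes to `1#`, so the numeral one in a solver equation
  -- is `1#` itself and goals match by computation.
  fromℤ : ℤ → Carrier
  fromℤ (+ n)    = n · 1#
  fromℤ -[1+ n ] = - (suc n · 1#)

  fromℤ-⊖ : ∀ m n → fromℤ (m ℤ.⊖ n) ≈ m · 1# - n · 1#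
  fromℤ-⊖ m       zero    = sym (trans (+-congˡ -0#≈0#) (+-identityʳ _))
  fromℤ-⊖ zero    (suc n) = sym (+-identityˡ _)
  fromℤ-⊖ (suc m) (suc n) = begin
    fromℤ (suc m ℤ.⊖ suc n)             ≡⟨ ≡.cong fromℤ (ℤ.[1+m]⊖[1+n]≡m⊖n m n) ⟩
    fromℤ (m ℤ.⊖ n)                     ≈⟨ fromℤ-⊖ m n ⟩
    m · 1# - n · 1#                     ≈⟨ +-congʳ (+-identityʳ _) ⟨
    (m · 1# + 0#) - n · 1#              ≈⟨ +-congʳ (+-congˡ (-‿inverseʳ 1#)) ⟨
    (m · 1# + (1# - 1#)) - n · 1#       ≈⟨ +-congʳ (+-assoc _ _ _) ⟨
    (m · 1# + 1# - 1#) - n · 1#         ≈⟨ +-assoc _ _ _ ⟩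
    (m · 1# + 1#) + (- 1# - n · 1#)     ≈⟨ +-cong (+-comm _ _) (⁻¹-∙-comm _ _) ⟩
    (1# + m · 1#) - (1# + n · 1#)       ≈⟨ +-cong (1+× m 1#) (-‿cong (1+× n 1#)) ⟨
    suc m · 1# - suc n · 1#             ∎

  fromℤ-neg : ∀ i → fromℤ (ℤ.- i) ≈ - fromℤ i
  fromℤ-neg (+ zero)  = sym -0#≈0#
  fromℤ-neg (+ suc n) = refl
  fromℤ-neg -[1+ n ]  = sym (-‿involutive _)

  fromℤ-+ : ∀ i j → fromℤ (i ℤ.+ j) ≈ fromℤ i + fromℤ j
  fromℤ-+ (+ m)    (+ n)    = ×-homo-+ 1# m n
  fromℤ-+ (+ m)    -[1+ n ] = fromℤ-⊖ m (suc n)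
  fromℤ-+ -[1+ m ] (+ n)    = trans (fromℤ-⊖ n (suc m)) (+-comm _ _)
  fromℤ-+ -[1+ m ] -[1+ n ] = begin
    - (suc (suc (m ℕ.+ n)) · 1#)     ≡⟨ ≡.cong (λ k → - (suc k · 1#)) (ℕ.+-suc m n) ⟨
    - ((suc m ℕ.+ suc n) · 1#)       ≈⟨ -‿cong (×-homo-+ 1# (suc m) (suc n)) ⟩
    - (suc m · 1# + suc n · 1#)      ≈⟨ ⁻¹-∙-comm _ _ ⟨
    - (suc m · 1#) - (suc n · 1#)    ∎

  fromℤ-*⁺ : ∀ m j → fromℤ (+ m ℤ.* j) ≈ m · 1# * fromℤ j
  fromℤ-*⁺ m (+ n) = begin
    fromℤ (+ m ℤ.* + n)     ≡⟨ ≡.cong fromℤ (ℤ.pos-* m n) ⟨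
    (m ℕ.* n) · 1#          ≈⟨ ×1-homo-* m n ⟩
    (m · 1#) * (n · 1#)     ∎
  fromℤ-*⁺ m -[1+ n ] = begin
    fromℤ (+ m ℤ.* -[1+ n ])        ≡⟨ ≡.cong fromℤ (ℤ.neg-distribʳ-* (+ m) (+ suc n)) ⟨
    fromℤ (ℤ.- (+ m ℤ.* + suc n))   ≈⟨ fromℤ-neg (+ m ℤ.* + suc n) ⟩
    - fromℤ (+ m ℤ.* + suc n)       ≈⟨ -‿cong (fromℤ-*⁺ m (+ suc n)) ⟩
    - (m · 1# * (suc n · 1#))       ≈⟨ -‿distribʳ-* _ _ ⟩
    m · 1# * - (suc n · 1#)         ∎

  fromℤ-* : ∀ i j → fromℤ (i ℤ.* j) ≈ fromℤ i * fromℤ j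
  fromℤ-* (+ m)    j = fromℤ-*⁺ m j
  fromℤ-* -[1+ m ] j = begin
    fromℤ (-[1+ m ] ℤ.* j)          ≡⟨ ≡.cong fromℤ (ℤ.neg-distribˡ-* (+ suc m) j) ⟨
    fromℤ (ℤ.- (+ suc m ℤ.* j))     ≈⟨ fromℤ-neg (+ suc m ℤ.* j) ⟩
    - fromℤ (+ suc m ℤ.* j)         ≈⟨ -‿cong (fromℤ-*⁺ (suc m) j) ⟩
    - (suc m · 1# * fromℤ j)        ≈⟨ -‿distribˡ-* _ _ ⟩
    - (suc m · 1#) * fromℤ j        ∎

  ℤ-rawRing : RawRing _ _
  ℤ-rawRing = record
    { _≈_ = _≡_ ; _+_ = ℤ._+_ ; _*_ = ℤ._*_ ; -_ = ℤ.-_ ; 0# = + 0 ; 1# = + 1 }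

  fromℤ-homo : ℤ-rawRing -Raw-AlmostCommutative⟶ fromCommutativeRing R
  fromℤ-homo = record
    { ⟦_⟧    = fromℤ
    ; +-homo = fromℤ-+
    ; *-homo = fromℤ-*
    ; -‿homo = fromℤ-neg
    ; 0-homo = refl
    ; 1-homo = refl
    }

  fromℤ-≟ : ∀ i j → Maybe (fromℤ i ≈ fromℤ j)
  fromℤ-≟ i j = Maybe.map (λ i≡j → reflexive (≡.cong fromℤ i≡j)) (dec⇒maybe (i ℤ.≟ j))

  open RingSolver ℤ-rawRing (fromCommutativeRing R) fromℤ-homo fromℤ-≟ public
    using (Polynomial; solve; con; :-_; _:+_; _:*_; _:-_; _:=_)

-- Ordered field arithmetic, suprema and infima

module OrderedField {ℓ : Level} (ℝ : CompleteOrderedField ℓ) where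
  open CompleteOrderedField ℝ
  open CommutativeRing commutativeRing public using
    ( refl; sym; trans; reflexive; +-cong; +-congˡ; +-congʳ; +-assoc; +-comm; +-identityˡ; +-identityʳ
    ; -‿inverseʳ; -‿inverseˡ; -‿cong; *-cong; *-congˡ; *-congʳ; *-assoc; *-comm; *-identityˡ
    ; *-identityʳ; distribˡ; zeroˡ; zeroʳ)
  open IntegerCoefficients commutativeRing public
    using (Polynomial; solve; con; :-_; _:+_; _:*_; _:-_; _:=_)
  open IsStrictTotalOrder isStrictTotalOrder public
    using (<-respˡ-≈; <-respʳ-≈; irrefl)
    renaming (trans to <-trans)
  open import Relation.Binary.Reasoning.Setoid setoid
  private
    module NS = StrictToNonStrict _≈_ _<_

  :0 :1 : ∀ {n} → Polynomial n
  :0 {n} = con {n} (+ 0)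
  :1 {n} = con {n} (+ 1)

  ≤-refl : ∀ {x} → x ≤ x
  ≤-refl = inj₂ refl

  ≤-respʳ : ∀ {x y z} → y ≈ z → x ≤ y → x ≤ z
  ≤-respʳ = NS.≤-respʳ-≈ trans <-respʳ-≈

  ≤-respˡ : ∀ {x y z} → x ≈ y → x ≤ z → y ≤ z
  ≤-respˡ = NS.≤-respˡ-≈ sym trans <-respˡ-≈

  ≤-antisym : ∀ {x y} → x ≤ y → y ≤ x → x ≈ y
  ≤-antisym = NS.antisym (IsStrictTotalOrder.isEquivalence isStrictTotalOrder) <-trans irrefl

  ≤-trans : ∀ {x y z} → x ≤ y → y ≤ z → x ≤ z
  ≤-trans = NS.trans (IsStrictTotalOrder.isEquivalence isStrictTotalOrder)
              (<-respʳ-≈ , <-respˡ-≈) <-trans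

  <-≤-trans : ∀ {x y z} → x < y → y ≤ z → x < z
  <-≤-trans = NS.<-≤-trans <-trans <-respʳ-≈

  ≤-<-trans : ∀ {x y z} → x ≤ y → y < z → x < z
  ≤-<-trans = NS.≤-<-trans sym <-trans <-respˡ-≈

  ≮⇒≥ : ∀ {x y} → ¬ x < y → y ≤ x
  ≮⇒≥ {x} {y} x≮y with compare x y
  ... | tri< x<y _ _ = contradiction x<y x≮y
  ... | tri≈ _ x≈y _ = inj₂ (sym x≈y)
  ... | tri> _ _ y<x = inj₁ y<x

  -- Linear arithmetic is done by exhibiting the difference of the two sides as
  -- a positive combination of the hypotheses, up to a ring identity.
  <-diff : ∀ {x y d} → 0# < d → y ≈ x + d → x < y
  <-diff {x} 0<d y≈x+d =
    <-respʳ-≈ (sym y≈x+d) (<-respˡ-≈ (+-identityʳ x) (+-monoʳ-< x 0<d))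

  ≤-diff : ∀ {x y d} → 0# ≤ d → y ≈ x + d → x ≤ y
  ≤-diff (inj₁ 0<d) y≈x+d = inj₁ (<-diff 0<d y≈x+d)
  ≤-diff {x} (inj₂ 0≈d) y≈x+d =
    inj₂ (sym (trans y≈x+d (trans (+-congˡ (sym 0≈d)) (+-identityʳ x))))

  0<y-x : ∀ {x y} → x < y → 0# < y - x
  0<y-x {x} {y} x<y = <-respˡ-≈ (-‿inverseˡ x) (<-respʳ-≈ (+-comm _ _) (+-monoʳ-< (- x) x<y))

  0≤y-x : ∀ {x y} → x ≤ y → 0# ≤ y - x
  0≤y-x (inj₁ x<y) = inj₁ (0<y-x x<y)
  0≤y-x {x} (inj₂ x≈y) = inj₂ (sym (trans (+-congʳ (sym x≈y)) (-‿inverseʳ x)))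

  +-pos : ∀ {x y} → 0# < x → 0# < y → 0# < x + y
  +-pos {x} 0<x 0<y = <-trans 0<x (<-diff 0<y refl)

  +-pos-nonneg : ∀ {x y} → 0# < x → 0# ≤ y → 0# < x + y
  +-pos-nonneg 0<x 0≤y = <-≤-trans 0<x (≤-diff 0≤y refl)

  +-nonneg : ∀ {x y} → 0# ≤ x → 0# ≤ y → 0# ≤ x + y
  +-nonneg 0≤x 0≤y = ≤-trans 0≤x (≤-diff 0≤y refl)

  *-nonneg : ∀ {x y} → 0# ≤ x → 0# ≤ y → 0# ≤ x * y
  *-nonneg (inj₁ 0<x) (inj₁ 0<y) = inj₁ (*-positive 0<x 0<y)
  *-nonneg (inj₂ 0≈x) _          = inj₂ (sym (trans (*-congʳ (sym 0≈x)) (zeroˡ _)))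
  *-nonneg _          (inj₂ 0≈y) = inj₂ (sym (trans (*-congˡ (sym 0≈y)) (zeroʳ _)))

  +-mono-≤ : ∀ {x y u v} → x ≤ y → u ≤ v → x + u ≤ y + v
  +-mono-≤ {x} {y} {u} {v} x≤y u≤v = ≤-diff (+-nonneg (0≤y-x x≤y) (0≤y-x u≤v))
    (solve 4 (λ x y u v → y :+ v := x :+ u :+ ((y :- x) :+ (v :- u))) refl x y u v)

  +-mono-< : ∀ {a b c d} → a < b → c < d → a + c < b + d
  +-mono-< {a} {b} {c} {d} a<b c<d = <-diff (+-pos (0<y-x a<b) (0<y-x c<d))
    (solve 4 (λ a b c d → b :+ d := a :+ c :+ ((b :- a) :+ (d :- c))) refl a b c d)

  *-monoʳ-≤ : ∀ {x y z} → 0# ≤ z → x ≤ y → z * x ≤ z * y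
  *-monoʳ-≤ {x} {y} {z} 0≤z x≤y = ≤-diff (*-nonneg 0≤z (0≤y-x x≤y))
    (solve 3 (λ x y z → z :* y := z :* x :+ z :* (y :- x)) refl x y z)

  -‿anti-≤ : ∀ {x y} → x ≤ y → - y ≤ - x
  -‿anti-≤ {x} {y} x≤y = ≤-diff (0≤y-x x≤y)
    (solve 2 (λ x y → :- x := :- y :+ (y :- x)) refl x y)

  -x≤x : ∀ {x} → 0# < x → - x ≤ x
  -x≤x {x} 0<x = inj₁ (<-diff (+-pos 0<x 0<x) (solve 1 (λ a → a := :- a :+ (a :+ a)) refl x))

  square-nonneg : ∀ x → 0# ≤ x * x
  square-nonneg x with compare 0# x
  ... | tri< 0<x _ _ = inj₁ (*-positive 0<x 0<x)
  ... | tri≈ _ 0≈x _ = *-nonneg (inj₂ 0≈x) (inj₂ 0≈x)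
  ... | tri> _ _ x<0 = inj₁ (<-respʳ-≈ (solve 1 (λ x → (:0 :- x) :* (:0 :- x) := x :* x) refl x)
                               (*-positive (0<y-x x<0) (0<y-x x<0)))

  pos⇒≉0 : ∀ {x} → 0# < x → ¬ (x ≈ 0#)
  pos⇒≉0 0<x x≈0 = irrefl (sym x≈0) 0<x

  *-inverseˡ : ∀ x → ¬ (x ≈ 0#) → x ⁻¹ * x ≈ 1#
  *-inverseˡ x x≉0 = trans (*-comm _ _) (*-inverseʳ x x≉0)

  x≉0⇒x⁻¹≉0 : ∀ {x} → ¬ (x ≈ 0#) → ¬ (x ⁻¹ ≈ 0#)
  x≉0⇒x⁻¹≉0 {x} x≉0 x⁻¹≈0 = pos⇒≉0 0<1 (begin
    1#        ≈⟨ *-inverseʳ x x≉0 ⟨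
    x * x ⁻¹  ≈⟨ *-congˡ x⁻¹≈0 ⟩
    x * 0#    ≈⟨ zeroʳ x ⟩
    0#        ∎)

  ⁻¹-positive : ∀ {x} → 0# < x → 0# < x ⁻¹
  ⁻¹-positive {x} 0<x with compare 0# (x ⁻¹)
  ... | tri< 0<x⁻¹ _ _ = 0<x⁻¹
  ... | tri≈ _ 0≈x⁻¹ _ = contradiction (sym 0≈x⁻¹) (x≉0⇒x⁻¹≉0 (pos⇒≉0 0<x))
  ... | tri> _ _ x⁻¹<0 = contradiction 0<0 (irrefl refl)
    where
    0<0 : 0# < 0#
    0<0 = <-respʳ-≈ (begin
      1# + x * (0# - x ⁻¹)    ≈⟨ +-congʳ (*-inverseʳ x (pos⇒≉0 0<x)) ⟨
      x * x ⁻¹ + x * (0# - x ⁻¹)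
        ≈⟨ solve 2 (λ x y → x :* y :+ x :* (:0 :- y) := :0) refl x (x ⁻¹) ⟩
      0#                      ∎)
      (+-pos 0<1 (*-positive 0<x (0<y-x x⁻¹<0)))

  ⁻¹-unique : ∀ {x y} → ¬ (x ≈ 0#) → x * y ≈ 1# → x ⁻¹ ≈ y
  ⁻¹-unique {x} {y} x≉0 xy≈1 = begin
    x ⁻¹            ≈⟨ *-identityʳ _ ⟨
    x ⁻¹ * 1#       ≈⟨ *-congˡ xy≈1 ⟨
    x ⁻¹ * (x * y)  ≈⟨ *-assoc _ _ _ ⟨
    x ⁻¹ * x * y    ≈⟨ *-congʳ (*-inverseˡ x x≉0) ⟩
    1# * y          ≈⟨ *-identityˡ y ⟩
    y               ∎

  *-≉0 : ∀ {x y} → ¬ (x ≈ 0#) → ¬ (y ≈ 0#) → ¬ (x * y ≈ 0#)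
  *-≉0 {x} {y} x≉0 y≉0 xy≈0 = y≉0 (begin
    y               ≈⟨ *-identityˡ y ⟨
    1# * y          ≈⟨ *-congʳ (*-inverseˡ x x≉0) ⟨
    x ⁻¹ * x * y    ≈⟨ *-assoc _ _ _ ⟩
    x ⁻¹ * (x * y)  ≈⟨ *-congˡ xy≈0 ⟩
    x ⁻¹ * 0#       ≈⟨ zeroʳ _ ⟩
    0#              ∎)

  ⁻¹-distrib-* : ∀ {x y} → ¬ (x ≈ 0#) → ¬ (y ≈ 0#) → (x * y) ⁻¹ ≈ x ⁻¹ * y ⁻¹
  ⁻¹-distrib-* {x} {y} x≉0 y≉0 = ⁻¹-unique (*-≉0 x≉0 y≉0) (begin
    x * y * (x ⁻¹ * y ⁻¹)
      ≈⟨ solve 4 (λ x y u v → x :* y :* (u :* v) := x :* u :* (y :* v)) refl x y _ _ ⟩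
    x * x ⁻¹ * (y * y ⁻¹)  ≈⟨ *-cong (*-inverseʳ x x≉0) (*-inverseʳ y y≉0) ⟩
    1# * 1#                ≈⟨ *-identityʳ 1# ⟩
    1#                     ∎)

  0<2 : 0# < 1# + 1#
  0<2 = +-pos 0<1 0<1

  ½ : Carrier
  ½ = (1# + 1#) ⁻¹

  0<½ : 0# < ½
  0<½ = ⁻¹-positive 0<2

  ½+½ : ½ + ½ ≈ 1#
  ½+½ = trans (solve 1 (λ h → h :+ h := (:1 :+ :1) :* h) refl ½) (*-inverseʳ _ (pos⇒≉0 0<2))

  min-positive : ∀ {x y} → 0# < x → 0# < y → ∃[ z ] (0# < z × z ≤ x × z ≤ y)
  min-positive {x} {y} 0<x 0<y with compare x y
  ... | tri< x<y _ _ = x , 0<x , ≤-refl , inj₁ x<y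
  ... | tri≈ _ x≈y _ = x , 0<x , ≤-refl , inj₂ x≈y
  ... | tri> _ _ y<x = y , 0<y , inj₁ y<x , ≤-refl

  half<self : ∀ {x} → 0# < x → x * ½ < x
  half<self {x} 0<x = <-diff (*-positive 0<x 0<½)
    (trans (sym (*-identityʳ x)) (trans (*-congˡ (sym ½+½)) (distribˡ x ½ ½)))

  module Supremum {P : Pred Carrier ℓ} where
    -- `lim↑1` is the supremum of the set of all limits, so evaluating it means showing that this
    -- set has a single member up to `≈`.
    ⨆-singleton : ∀ {b} → P b → (∀ {x} → P x → x ≈ b) → ⨆ P ≈ b
    ⨆-singleton {b} Pb unique =
      ≤-antisym (⨆-least (b , Pb) (b , below) below) (⨆-upper (b , Pb) (b , below) Pb)
      where
      below : IsUpperBound P b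
      below Px = inj₂ (unique Px)

    -- `⨅ P` is the negated supremum of the reflected set, so `x` enters it as `- (- x)`; `resp`
    -- carries membership across that. The bound and the inhabitant are what the axioms for `⨆`
    -- demand.
    module Infimum (resp : ∀ {x y} → x ≈ y → P x → P y) {b : Carrier} (bounded : ∀ {x} → P x → b ≤ x)
                   (inhabited : ∃[ x ] P x) where
      private
        -P : Pred Carrier ℓ
        -P x = P (- x)

        neg-neg : ∀ x → - (- x) ≈ x
        neg-neg = solve 1 (λ x → :- (:- x) := x) refl

        -inhabited : ∃[ x ] -P x
        -inhabited = let x , Px = inhabited in - x , resp (sym (neg-neg x)) Px

        -bounded : ∀ {c} → (∀ {x} → P x → c ≤ x) → IsUpperBound -P (- c)
        -bounded below {x} P-x = ≤-respˡ (neg-neg x) (-‿anti-≤ (below P-x))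

      ⨅-lower : ∀ {x} → P x → ⨅ P ≤ x
      ⨅-lower {x} Px = ≤-respʳ (neg-neg x)
        (-‿anti-≤ (⨆-upper -inhabited (- b , -bounded bounded) (resp (sym (neg-neg x)) Px)))

      ⨅-greatest : ∀ {c} → (∀ {x} → P x → c ≤ x) → c ≤ ⨅ P
      ⨅-greatest {c} below = ≤-respˡ (neg-neg c)
        (-‿anti-≤ (⨆-least -inhabited (- b , -bounded bounded) (-bounded below)))

-- Finite sums, restricted sums and sums over pairs

module FiniteSums {ℓ : Level} (ℝ : CompleteOrderedField ℓ) where
  open CompleteOrderedField ℝ
  open OrderedField ℝ
  open LinearAlgebra ℝ
  open import Algebra.Properties.Semiring.Sum semiring public
    using (sum-cong-≋; sum-replicate-zero; ∑-distrib-+; *-distribˡ-sum; *-distribʳ-sum; ∑-comm)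
  open import Relation.Binary.Reasoning.Setoid setoid

  when-yes : ∀ {p} {P : Set p} (P? : Dec P) {x} → P → when P? x ≈ x
  when-yes (yes _) _ = refl
  when-yes (no ¬p) p = contradiction p ¬p

  when-no : ∀ {p} {P : Set p} (P? : Dec P) {x} → ¬ P → when P? x ≈ 0#
  when-no (yes p) ¬p = contradiction p ¬p
  when-no (no _)  _  = refl

  when-cong : ∀ {p} {P : Set p} (P? : Dec P) {x y} → (P → x ≈ y) → when P? x ≈ when P? y
  when-cong (yes p) x≈y = x≈y p
  when-cong (no _)  _   = refl

  ≈-when : ∀ {p} {P : Set p} (P? : Dec P) {x y} → (P → y ≈ x) → (¬ P → y ≈ 0#) → y ≈ when P? x
  ≈-when (yes p) y≈x _   = y≈x p
  ≈-when (no ¬p) _   y≈0 = y≈0 ¬p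

  when-*ʳ : ∀ {p} {P : Set p} (P? : Dec P) {x y} → when P? x * y ≈ when P? (x * y)
  when-*ʳ (yes _) = refl
  when-*ʳ (no _)  = zeroˡ _

  when-*ˡ : ∀ {p} {P : Set p} (P? : Dec P) {x y} → y * when P? x ≈ when P? (y * x)
  when-*ˡ (yes _) = refl
  when-*ˡ (no _)  = zeroʳ _

  when-+ : ∀ {p} {P : Set p} (P? : Dec P) {x y} → when P? x + when P? y ≈ when P? (x + y)
  when-+ (yes _) = refl
  when-+ (no _)  = +-identityˡ _

  when-nonneg : ∀ {p} {P : Set p} (P? : Dec P) {x} → (P → 0# ≤ x) → 0# ≤ when P? x
  when-nonneg (yes p) 0≤x = 0≤x p
  when-nonneg (no _)  _   = ≤-refl

  ∑-zero : ∀ {n} (g : Vector Carrier n) → (∀ i → g i ≈ 0#) → sum g ≈ 0#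
  ∑-zero {n} g g≈0 = trans (sum-cong-≋ g≈0) (sum-replicate-zero n)

  ∑-when-none : ∀ {n p} {P : Pred (Fin n) p} (P? : Decidable P) (g : Vector Carrier n) →
                (∀ i → ¬ P i) → ∑[ i < n ] when (P? i) (g i) ≈ 0#
  ∑-when-none P? g ¬P = ∑-zero _ λ i → when-no (P? i) (¬P i)

  ∑-when-unique : ∀ {n p} {P : Pred (Fin n) p} (P? : Decidable P) (g : Vector Carrier n) (i : Fin n) →
                  P i → (∀ {j} → P j → j ≡ i) → ∑[ j < n ] when (P? j) (g j) ≈ g i
  ∑-when-unique {suc n} P? g zero Pi unique = trans
    (+-cong (when-yes (P? zero) Pi)
            (∑-when-none (P? ∘ suc) (g ∘ suc) λ j Pj → contradiction (unique Pj) λ ()))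
    (+-identityʳ _)
  ∑-when-unique {suc n} P? g (suc i) Pi unique = trans
    (+-cong (when-no (P? zero) λ P0 → contradiction (unique P0) λ ())
            (∑-when-unique (P? ∘ suc) (g ∘ suc) i Pi (Fin.suc-injective ∘ unique)))
    (+-identityˡ _)

  ∑-nonneg : ∀ {n} (g : Vector Carrier n) → (∀ i → 0# ≤ g i) → 0# ≤ sum g
  ∑-nonneg {zero}  g 0≤g = ≤-refl
  ∑-nonneg {suc n} g 0≤g = +-nonneg (0≤g zero) (∑-nonneg (g ∘ suc) (0≤g ∘ suc))

  ∑-mono-≤ : ∀ {n} {f g : Vector Carrier n} → (∀ i → f i ≤ g i) → sum f ≤ sum g
  ∑-mono-≤ {zero}  f≤g = ≤-refl
  ∑-mono-≤ {suc n} f≤g = +-mono-≤ (f≤g zero) (∑-mono-≤ (f≤g ∘ suc))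

  ∑-pos : ∀ {n} (g : Vector Carrier n) → (∀ i → 0# ≤ g i) → ∀ i → 0# < g i → 0# < sum g
  ∑-pos g 0≤g zero    0<gi = +-pos-nonneg 0<gi (∑-nonneg (g ∘ suc) (0≤g ∘ suc))
  ∑-pos g 0≤g (suc i) 0<gi =
    <-≤-trans (∑-pos (g ∘ suc) (0≤g ∘ suc) i 0<gi)
      (≤-respʳ (+-comm _ _) (≤-diff (0≤g zero) refl))

  ∑-neg : ∀ {n} (f : Vector Carrier n) → ∑[ i < n ] (- f i) ≈ - sum f
  ∑-neg {n} f = begin
    ∑[ i < n ] (- f i)         ≈⟨ sum-cong-≋ (λ i → solve 1 (λ x → :- x := :- :1 :* x) refl (f i)) ⟩
    ∑[ i < n ] (- 1# * f i)    ≈⟨ *-distribˡ-sum (- 1#) f ⟨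
    - 1# * sum f               ≈⟨ solve 1 (λ x → :- :1 :* x := :- x) refl (sum f) ⟩
    - sum f                    ∎

  ∑-distrib-‿- : ∀ {n} (f g : Vector Carrier n) → ∑[ i < n ] (f i - g i) ≈ sum f - sum g
  ∑-distrib-‿- f g = trans (∑-distrib-+ f (λ i → - g i)) (+-congˡ (∑-neg g))

  -- The part below the diagonal is folded onto the part above by exchanging the two sums, which
  -- renames `(i , j)` to `(j , i)`.
  ∑∑-pairs : ∀ {n} (G : Fin n → Fin n → Carrier) → (∀ i → G i i ≈ 0#) →
             ∑[ i < n ] ∑[ j < n ] G i j ≈ ∑[ i < n ] ∑[ j < n ] when (i Fin.<? j) (G i j + G j i)
  ∑∑-pairs {n} G diagonal = begin
    ∑[ i < n ] ∑[ j < n ] G i j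
      ≈⟨ sum-cong-≋ (λ i → trans (sum-cong-≋ (λ j → halves i j))
           (∑-distrib-+ (λ j → when (i Fin.<? j) (G i j)) (λ j → when (j Fin.<? i) (G i j)))) ⟩
    ∑[ i < n ] (∑[ j < n ] when (i Fin.<? j) (G i j) + ∑[ j < n ] when (j Fin.<? i) (G i j))
      ≈⟨ ∑-distrib-+ (λ i → ∑[ j < n ] when (i Fin.<? j) (G i j)) (λ i → ∑[ j < n ] when (j Fin.<? i) (G i j)) ⟩
    ∑[ i < n ] ∑[ j < n ] when (i Fin.<? j) (G i j) + ∑[ i < n ] ∑[ j < n ] when (j Fin.<? i) (G i j)
      ≈⟨ +-congˡ (∑-comm (λ i j → when (j Fin.<? i) (G i j))) ⟩
    ∑[ i < n ] ∑[ j < n ] when (i Fin.<? j) (G i j) + ∑[ i < n ] ∑[ j < n ] when (i Fin.<? j) (G j i)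
      ≈⟨ ∑-distrib-+ (λ i → ∑[ j < n ] when (i Fin.<? j) (G i j)) (λ i → ∑[ j < n ] when (i Fin.<? j) (G j i)) ⟨
    ∑[ i < n ] (∑[ j < n ] when (i Fin.<? j) (G i j) + ∑[ j < n ] when (i Fin.<? j) (G j i))
      ≈⟨ sum-cong-≋ (λ i → trans
           (sym (∑-distrib-+ (λ j → when (i Fin.<? j) (G i j)) (λ j → when (i Fin.<? j) (G j i))))
           (sum-cong-≋ λ j → when-+ (i Fin.<? j) {G i j} {G j i})) ⟩
    ∑[ i < n ] ∑[ j < n ] when (i Fin.<? j) (G i j + G j i)  ∎
    where
    halves : ∀ i j → G i j ≈ when (i Fin.<? j) (G i j) + when (j Fin.<? i) (G i j)
    halves i j with Fin.<-cmp i j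
    ... | tri< i<j _ j≮i = sym (trans
      (+-cong (when-yes (i Fin.<? j) i<j) (when-no (j Fin.<? i) j≮i)) (+-identityʳ _))
    ... | tri> i≮j _ j<i = sym (trans
      (+-cong (when-no (i Fin.<? j) i≮j) (when-yes (j Fin.<? i) j<i)) (+-identityˡ _))
    ... | tri≈ i≮i ≡.refl _ = trans (diagonal i) (sym (trans
      (+-cong (when-no (i Fin.<? i) i≮i) (when-no (i Fin.<? i) i≮i)) (+-identityˡ _)))

  -- Degrees filter `allFin`, that is `tabulate id`; a general `f` is what lets the induction move
  -- on to `f ∘ suc`.
  fromℕ-length-filter : ∀ {m n p} {P : Pred (Fin m) p} (P? : Decidable P) (f : Fin n → Fin m) →
                        fromℕ (length (filter P? (tabulate f))) ≈ ∑[ i < n ] when (P? (f i)) 1#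
  fromℕ-length-filter {n = zero}  P? f = refl
  fromℕ-length-filter {n = suc n} P? f with P? (f zero)
  ... | yes _ = +-congˡ (fromℕ-length-filter P? (f ∘ suc))
  ... | no _  = trans (fromℕ-length-filter P? (f ∘ suc)) (sym (+-identityˡ _))

-- Incidence and walks in simple graphs

module GraphProperties (G : Graph) where
  open Graph G

  joins? : ∀ e x y → Dec (Joins e x y)
  joins? e x y =
    ((lo e Fin.≟ x) ×-dec (hi e Fin.≟ y)) ⊎-dec ((lo e Fin.≟ y) ×-dec (hi e Fin.≟ x))

  lo≢hi : ∀ e → lo e ≢ hi e
  lo≢hi e = Fin.<⇒≢ (lo<hi e)

  joins-irrefl : ∀ {e x} → ¬ Joins e x x
  joins-irrefl {e} (inj₁ (lo≡x , hi≡x)) = lo≢hi e (≡.trans lo≡x (≡.sym hi≡x))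
  joins-irrefl {e} (inj₂ (lo≡x , hi≡x)) = lo≢hi e (≡.trans lo≡x (≡.sym hi≡x))

  joins-sym : ∀ {e x y} → Joins e x y → Joins e y x
  joins-sym (inj₁ j) = inj₂ j
  joins-sym (inj₂ j) = inj₁ j

  joins-unique : ∀ {e f x y} → Joins e x y → Joins f x y → e ≡ f
  joins-unique (inj₁ (≡.refl , ≡.refl)) (inj₁ (p , q)) = injective (≡.sym p) (≡.sym q)
  joins-unique (inj₂ (≡.refl , ≡.refl)) (inj₂ (p , q)) = injective (≡.sym p) (≡.sym q)
  joins-unique {e} {f} (inj₁ (≡.refl , ≡.refl)) (inj₂ (p , q)) =
    contradiction (≡.subst₂ Fin._<_ p q (lo<hi f)) (Fin.<-asym (lo<hi e))
  joins-unique {e} {f} (inj₂ (≡.refl , ≡.refl)) (inj₁ (p , q)) =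
    contradiction (≡.subst₂ Fin._<_ p q (lo<hi f)) (Fin.<-asym (lo<hi e))

  joins⇒∈ˡ : ∀ {e x y} → Joins e x y → x ∈ₑ e
  joins⇒∈ˡ (inj₁ (lo≡x , _)) = inj₁ (≡.sym lo≡x)
  joins⇒∈ˡ (inj₂ (_ , hi≡x)) = inj₂ (≡.sym hi≡x)

  ∈⇒joins : ∀ {e x} → x ∈ₑ e → ∃[ y ] Joins e x y
  ∈⇒joins {e} (inj₁ ≡.refl) = hi e , inj₁ (≡.refl , ≡.refl)
  ∈⇒joins {e} (inj₂ ≡.refl) = lo e , inj₂ (≡.refl , ≡.refl)

  joins-functional : ∀ {e x y z} → Joins e x y → Joins e x z → y ≡ z
  joins-functional (inj₁ (≡.refl , ≡.refl)) (inj₁ (_ , q)) = q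
  joins-functional (inj₂ (≡.refl , ≡.refl)) (inj₂ (p , _)) = p
  joins-functional {e} (inj₁ (≡.refl , ≡.refl)) (inj₂ (_ , q)) = contradiction (≡.sym q) (lo≢hi e)
  joins-functional {e} (inj₂ (≡.refl , ≡.refl)) (inj₁ (p , _)) = contradiction p (lo≢hi e)

  ∈∈⇒joins : ∀ {e x y} → x ≢ y → x ∈ₑ e → y ∈ₑ e → Joins e x y
  ∈∈⇒joins x≢y (inj₁ x≡lo) (inj₂ y≡hi) = inj₁ (≡.sym x≡lo , ≡.sym y≡hi)
  ∈∈⇒joins x≢y (inj₂ x≡hi) (inj₁ y≡lo) = inj₂ (≡.sym y≡lo , ≡.sym x≡hi)
  ∈∈⇒joins x≢y (inj₁ x≡lo) (inj₁ y≡lo) = contradiction (≡.trans x≡lo (≡.sym y≡lo)) x≢y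
  ∈∈⇒joins x≢y (inj₂ x≡hi) (inj₂ y≡hi) = contradiction (≡.trans x≡hi (≡.sym y≡hi)) x≢y

  -- Two distinct common vertices would make `e` and `f` join the same pair. Because of this, it
  -- does not matter which witness `shareVertex?` returns in the definition of `a`.
  shared-unique : ∀ {e f x y} → e ≢ f → x ∈ₑ e → x ∈ₑ f → y ∈ₑ e → y ∈ₑ f → x ≡ y
  shared-unique {x = x} {y} e≢f x∈e x∈f y∈e y∈f with x Fin.≟ y
  ... | yes x≡y = x≡y
  ... | no x≢y  = contradiction (joins-unique (∈∈⇒joins x≢y x∈e y∈e) (∈∈⇒joins x≢y x∈f y∈f)) e≢f

  infixr 5 _++_

  _++_ : ∀ {x y z} → Walk x y → Walk y z → Walk x z
  []         ++ q = q
  step e j p ++ q = step e j (p ++ q)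

  target∈ : ∀ {x y} (p : Walk x y) → y ∈ vertices p
  target∈ []           = here ≡.refl
  target∈ (step _ _ p) = there (target∈ p)

-- Exactness of 1-forms on trees

module PotentialTheory {ℓ : Level} (ℝ : CompleteOrderedField ℓ) (T : Tree) where
  open CompleteOrderedField ℝ
  open OrderedField ℝ
  open Tree T
  open GraphProperties graph public
  open import Data.List.Membership.DecPropositional (Fin._≟_ {∣V∣}) using (_∈?_)
  open import Relation.Binary.Reasoning.Setoid setoid

  -- θ is an antisymmetric 1-form: θ e is its value on e directed from lo e to hi e.
  module _ (θ : Edge → Carrier) where
    along : ∀ {e x y} → Joins e x y → Carrier
    along {e} (inj₁ _) = θ e
    along {e} (inj₂ _) = - θ e

    ∫ : ∀ {x y} → Walk x y → Carrier
    ∫ []           = 0#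
    ∫ (step _ j p) = along j + ∫ p

    ∫-++ : ∀ {x y z} (p : Walk x y) (q : Walk y z) → ∫ (p ++ q) ≈ ∫ p + ∫ q
    ∫-++ []           q = sym (+-identityˡ _)
    ∫-++ (step e j p) q = trans (+-congˡ (∫-++ p q)) (sym (+-assoc _ _ _))

    record Splitting {x y} (p : Walk x y) (v : Vertex) : Set ℓ where
      field
        before   : Walk x v
        after    : Walk v y
        path     : IsPath before
        path′    : IsPath after
        -- Serves the recursion in `split`: a vertex missing from `p` is missing from `before`, so
        -- putting it in front keeps the walk a path.
        ⊆-before : ∀ {z} → z ∈ vertices before → z ∈ vertices p
        ∫-split  : ∫ p ≈ ∫ before + ∫ after

    split : ∀ {x y v} (p : Walk x y) → IsPath p → v ∈ vertices p → Splitting p v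
    split [] path (here ≡.refl) = record
      { before = [] ; after = [] ; path = path ; path′ = path
      ; ⊆-before = λ z∈ → z∈ ; ∫-split = sym (+-identityˡ _) }
    split p@(step _ _ _) path (here ≡.refl) = record
      { before = [] ; after = p ; path = [] ∷ [] ; path′ = path
      ; ⊆-before = λ { (here z≡) → here z≡ } ; ∫-split = sym (+-identityˡ _) }
    split (step e j p) (x∉p ∷ path) (there v∈p) = record
      { before   = step e j S.before
      ; after    = S.after
      ; path     = All.tabulate (λ z∈ → All.lookup x∉p (S.⊆-before z∈)) ∷ S.path
      ; path′    = S.path′
      ; ⊆-before = λ where
          (here z≡)  → here z≡
          (there z∈) → there (S.⊆-before z∈)
      ; ∫-split  = trans (+-congˡ S.∫-split) (sym (+-assoc _ _ _))
      }
      where module S = Splitting (split p path v∈p)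

    -- Acyclicity rules out a return path of two or more steps. A single step back must use `e`
    -- itself, in the opposite direction, and the two contributions cancel.
    ∫-cycle : ∀ {e x y} (j : Joins e x y) (p : Walk y x) → IsPath p → along j + ∫ p ≈ 0#
    ∫-cycle j [] _ = contradiction j joins-irrefl
    ∫-cycle j p@(step _ _ (step _ _ _)) path =
      contradiction (_ , j) (acyclic p path (s≤s (s≤s z≤n)))
    ∫-cycle j (step f k []) _ with joins-unique j (joins-sym k)
    ∫-cycle (inj₁ _) (step f (inj₂ _) []) _ | ≡.refl = trans (+-congˡ (+-identityʳ _)) (-‿inverseʳ _)
    ∫-cycle (inj₂ _) (step f (inj₁ _) []) _ | ≡.refl = trans (+-congˡ (+-identityʳ _)) (-‿inverseˡ _)
    ∫-cycle (inj₁ (p , _)) (step f (inj₁ (q , r)) []) _ | ≡.refl =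
      contradiction (≡.trans p (≡.sym r)) (lo≢hi f)
    ∫-cycle (inj₂ (p , _)) (step f (inj₂ (q , r)) []) _ | ≡.refl =
      contradiction (≡.trans p (≡.sym r)) (lo≢hi f)

    -- Induction from the far end. If the start reappears in the erased remainder `q`, the edge `e`
    -- and the part of `q` before that visit form a closed trip of zero integral, and both are
    -- dropped.
    loopErasure : ∀ {x y} (p : Walk x y) → Σ[ q ∈ Walk x y ] (IsPath q × ∫ q ≈ ∫ p)
    loopErasure [] = [] , [] ∷ [] , refl
    loopErasure {x} (step e j p) with q , path , ∫q≈∫p ← loopErasure p with x ∈? vertices q
    ... | no x∉q = step e j q , ¬Any⇒All¬ _ x∉q ∷ path , +-congˡ ∫q≈∫p
    ... | yes x∈q = S.after , S.path′ , (begin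
      ∫ S.after                          ≈⟨ +-identityˡ _ ⟨
      0# + ∫ S.after                     ≈⟨ +-congʳ (∫-cycle j S.before S.path) ⟨
      along j + ∫ S.before + ∫ S.after   ≈⟨ +-assoc _ _ _ ⟩
      along j + (∫ S.before + ∫ S.after) ≈⟨ +-congˡ S.∫-split ⟨
      along j + ∫ q                      ≈⟨ +-congˡ ∫q≈∫p ⟩
      along j + ∫ p                      ∎)
      where module S = Splitting (split q path x∈q)

    ∫-closed : ∀ {x} (p : Walk x x) → ∫ p ≈ 0#
    ∫-closed p with loopErasure p
    ... | [] , _ , 0≈∫p = sym 0≈∫p
    ... | step _ _ q , x∉q ∷ _ , _ = contradiction ≡.refl (All.lookup x∉q (target∈ q))

    ∫-independent : ∀ {x y} (p q : Walk x y) → ∫ p ≈ ∫ q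
    ∫-independent {x} {y} p q = begin
      ∫ p                ≈⟨ solve 2 (λ a b → a := a :+ b :- b) refl (∫ p) (∫ r) ⟩
      ∫ p + ∫ r - ∫ r    ≈⟨ +-congʳ (trans (sym (∫-++ p r)) (∫-closed (p ++ r))) ⟩
      0# - ∫ r           ≈⟨ +-congʳ (trans (sym (∫-++ q r)) (∫-closed (q ++ r))) ⟨
      ∫ q + ∫ r - ∫ r    ≈⟨ solve 2 (λ a b → a :+ b :- b := a) refl (∫ q) (∫ r) ⟩
      ∫ q                ∎
      where r = connected y x

    -- Integrating from `v` to the root makes the potential fall in the direction of θ: its value at
    -- `u` minus its value at `v` is the integral from `u` to `v`, the sign in which the dual of
    -- `W₁` pairs source and target.
    potential : Vertex → Vertex → Carrier
    potential root v = ∫ (connected v root)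

    potential-step : ∀ root {e x y} (j : Joins e x y) → potential root x ≈ along j + potential root y
    potential-step root {e} {x} {y} j = ∫-independent (connected x root) (step e j (connected y root))

    potential-walk : ∀ root {x y} (p : Walk x y) → potential root x ≈ ∫ p + potential root y
    potential-walk root {x} {y} p =
      trans (∫-independent (connected x root) (p ++ connected y root)) (∫-++ p (connected y root))

-- Degrees and the number d_x - 2

two-members⇒2≤length : ∀ {A : Set} {xs : List A} {x y} → x ∈ xs → y ∈ xs → x ≢ y → 2 ℕ.≤ length xs
two-members⇒2≤length {xs = _ ∷ []}    (here ≡.refl) (here ≡.refl) x≢y = contradiction ≡.refl x≢y
two-members⇒2≤length {xs = _ ∷ _ ∷ _} _             _             _   = s≤s (s≤s z≤n)

module DegreeExcess {ℓ : Level} (ℝ : CompleteOrderedField ℓ) (G : Graph) where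
  open CompleteOrderedField ℝ
  open OrderedField ℝ
  open Graph G
  open import Algebra.Properties.Monoid.Mult +-monoid using (×-homo-+)
  open import Relation.Binary.Reasoning.Setoid setoid

  -- Subtracted in the field and not truncated in ℕ, since the curvature needs the value -1 at a
  -- leaf.
  excess : Vertex → Carrier
  excess x = fromℕ (degree x) - fromℕ 2

  fromℕ-nonneg : ∀ n → 0# ≤ fromℕ n
  fromℕ-nonneg zero    = ≤-refl
  fromℕ-nonneg (suc n) = +-nonneg (inj₁ 0<1) (fromℕ-nonneg n)

  excess-nonneg : ∀ {x} → 2 ℕ.≤ degree x → 0# ≤ excess x
  excess-nonneg {x} 2≤d with k , d≡2+k ← ℕ.m≤n⇒∃[o]m+o≡n 2≤d = ≤-respʳ
    (begin
      fromℕ k                      ≈⟨ solve 2 (λ a b → b := a :+ b :- a) refl (fromℕ 2) (fromℕ k) ⟩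
      fromℕ 2 + fromℕ k - fromℕ 2  ≈⟨ +-congʳ (×-homo-+ 1# 2 k) ⟨
      fromℕ (2 ℕ.+ k) - fromℕ 2    ≡⟨ ≡.cong (λ n → fromℕ n - fromℕ 2) d≡2+k ⟩
      excess x                     ∎)
    (fromℕ-nonneg k)

  2≤degree : ∀ {e f x} → e ≢ f → x ∈ₑ e → x ∈ₑ f → 2 ℕ.≤ degree x
  2≤degree {e} {f} {x} e≢f x∈e x∈f =
    two-members⇒2≤length (∈-filter⁺ (x ∈ₑ?_) (∈-allFin e) x∈e) (∈-filter⁺ (x ∈ₑ?_) (∈-allFin f) x∈f) e≢f

-- Kantorovich duality and the measures around a vertex

module Transport {ℓ : Level} (ℝ : CompleteOrderedField ℓ) (T : Tree)
                 (w : Curvature.Weight ℝ T) (w>0 : Curvature.Positive ℝ T w) where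
  open CompleteOrderedField ℝ
  open Tree T
  open Curvature ℝ T
  open OrderedField ℝ
  open LinearAlgebra ℝ
  open FiniteSums ℝ
  open DegreeExcess ℝ graph
  open Supremum
  open import Relation.Binary.Reasoning.Setoid setoid

  d : Vertex → Vertex → Carrier
  d = pathMetric w

  walkLength-nonneg : ∀ {x y} (p : Walk x y) → 0# ≤ walkLength w p
  walkLength-nonneg []           = ≤-refl
  walkLength-nonneg (step e _ p) = +-nonneg (inj₁ (w>0 e)) (walkLength-nonneg p)

  private
    module Length x y = Infimum {P = λ r → Σ[ p ∈ Walk x y ] walkLength w p ≈ r}
      (λ r≈s (p , ≈r) → p , trans ≈r r≈s)
      (λ (p , ≈r) → ≤-respʳ ≈r (walkLength-nonneg p))
      (_ , connected x y , refl)

  pathMetric-upper : ∀ {x y} (p : Walk x y) → d x y ≤ walkLength w p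
  pathMetric-upper {x} {y} p = Length.⨅-lower x y (p , refl)

  pathMetric-greatest : ∀ {x y c} → (∀ (p : Walk x y) → c ≤ walkLength w p) → c ≤ d x y
  pathMetric-greatest {x} {y} below = Length.⨅-greatest x y λ (p , ≈r) → ≤-respʳ ≈r (below p)

  infixl 7 _∙_
  _∙_ : Vector Carrier ∣V∣ → Vector Carrier ∣V∣ → Carrier
  μ ∙ Φ = ∑[ v < ∣V∣ ] (μ v * Φ v)

  -- Each half of the difference depends on one variable only, so summing out the other leaves a
  -- marginal. The value is therefore the same for all couplings of `μ` and `ν`.
  coupling-difference : ∀ {μ ν π} → IsCoupling μ ν π → ∀ Φ →
    ∑[ u < ∣V∣ ] ∑[ v < ∣V∣ ] (π u v * (Φ u - Φ v)) ≈ μ ∙ Φ - ν ∙ Φ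
  coupling-difference {μ} {ν} {π} coupling Φ = begin
    ∑[ u < ∣V∣ ] ∑[ v < ∣V∣ ] (π u v * (Φ u - Φ v))
      ≈⟨ sum-cong-≋ (λ u → trans (sum-cong-≋ λ v → expand (π u v) (Φ u) (Φ v))
                                 (∑-distrib-‿- (λ v → π u v * Φ u) (λ v → π u v * Φ v))) ⟩
    ∑[ u < ∣V∣ ] (∑[ v < ∣V∣ ] (π u v * Φ u) - ∑[ v < ∣V∣ ] (π u v * Φ v))
      ≈⟨ ∑-distrib-‿- (λ u → ∑[ v < ∣V∣ ] (π u v * Φ u)) (λ u → ∑[ v < ∣V∣ ] (π u v * Φ v)) ⟩
    ∑[ u < ∣V∣ ] ∑[ v < ∣V∣ ] (π u v * Φ u) - ∑[ u < ∣V∣ ] ∑[ v < ∣V∣ ] (π u v * Φ v)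
      ≈⟨ +-cong (sum-cong-≋ λ u → sym (*-distribʳ-sum (Φ u) (π u)))
                (-‿cong (trans (∑-comm (λ u v → π u v * Φ v)) (sum-cong-≋ λ v → sym (*-distribʳ-sum (Φ v) (λ u → π u v))))) ⟩
    ∑[ u < ∣V∣ ] (sum (π u) * Φ u) - ∑[ v < ∣V∣ ] (sum (λ u → π u v) * Φ v)
      ≈⟨ +-cong (sum-cong-≋ λ u → *-congʳ (marginalˡ u))
                (-‿cong (sum-cong-≋ λ v → *-congʳ (marginalʳ v))) ⟩
    μ ∙ Φ - ν ∙ Φ ∎
    where
    open IsCoupling coupling
    expand : ∀ p a b → p * (a - b) ≈ p * a - p * b
    expand = solve 3 (λ p a b → p :* (a :- b) := p :* a :- p :* b) refl

  -- Weak duality with complementary slackness: the dual value bounds the cost of every coupling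
  -- from below, and `π` attains it. Since `slack` carries the factor `π u v`, it asks nothing of
  -- pairs that receive no mass.
  W₁-optimal : ∀ {μ ν π} Φ → (∀ u v → Φ u - Φ v ≤ d u v) → IsCoupling μ ν π →
               (∀ u v → π u v * d u v ≈ π u v * (Φ u - Φ v)) →
               W₁ w μ ν ≈ μ ∙ Φ - ν ∙ Φ
  W₁-optimal {μ} {ν} {π} Φ lipschitz coupling slack = ≤-antisym
    (⨅-lower (π , coupling , cost≈))
    (⨅-greatest dual)
    where
    cost≈ : cost w π ≈ μ ∙ Φ - ν ∙ Φ
    cost≈ = trans (sum-cong-≋ λ u → sum-cong-≋ (slack u)) (coupling-difference coupling Φ)

    dual : ∀ {r} → ∃[ ρ ] (IsCoupling μ ν ρ × cost w ρ ≈ r) → μ ∙ Φ - ν ∙ Φ ≤ r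
    dual (ρ , coupling′ , ≈r) = ≤-respʳ ≈r (≤-respˡ (coupling-difference coupling′ Φ)
      (∑-mono-≤ λ u → ∑-mono-≤ λ v → *-monoʳ-≤ (IsCoupling.nonneg coupling′ u v) (lipschitz u v)))

    open Infimum {P = λ r → ∃[ ρ ] (IsCoupling μ ν ρ × cost w ρ ≈ r)}
      (λ r≈s (ρ , c , ≈r) → ρ , c , trans ≈r r≈s) dual (_ , π , coupling , refl)

  D>0 : ∀ {x e} → x ∈ₑ e → 0# < D w x
  D>0 {x} {e} x∈e = ∑-pos _
    (λ g → when-nonneg (x ∈ₑ? g) λ _ → inj₁ (⁻¹-positive (w>0 g))) e
    (<-respʳ-≈ (sym (when-yes (x ∈ₑ? e) x∈e)) (⁻¹-positive (w>0 e)))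

  -- The part of the measure m w α x that has left the vertex x.
  spread : Carrier → Vertex → Vector Carrier ∣V∣
  spread α x z = if does (x Fin.≟ z) then 0# else neighbourMass w α x (adjacent? x z)

  δ : Vertex → Vector Carrier ∣V∣
  δ x z = when (x Fin.≟ z) 1#

  m≈δ+spread : ∀ α x z → m w α x z ≈ α * δ x z + spread α x z
  m≈δ+spread α x z with does (x Fin.≟ z)
  ... | true  = sym (trans (+-identityʳ _) (*-identityʳ _))
  ... | false = sym (trans (+-congʳ (zeroʳ _)) (+-identityˡ _))

  δ-∙ : ∀ x Φ → δ x ∙ Φ ≈ Φ x
  δ-∙ x Φ = trans
    (sum-cong-≋ λ z → trans (when-*ʳ (x Fin.≟ z)) (when-cong (x Fin.≟ z) λ _ → *-identityˡ _))
    (∑-when-unique (x Fin.≟_) Φ x ≡.refl ≡.sym)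

  open GraphProperties graph

  -- At an end of e: +1 on the edges leading away from e, -1 on e itself.
  outward : Edge → Edge → Carrier
  outward e g = 1# - when (g Fin.≟ e) (1# + 1#)

  module _ (α : Carrier) (x : Vertex) where
    private
      mass : Edge → Carrier
      mass e = (1# - α) * (w e ⁻¹ / D w x)

    -- The graph is simple, so neighbours of `x` correspond to edges at `x`. Both sides are the sum
    -- over all incidences `Joins e x z`, grouped by `z` and by `e`.
    spread-∙ : ∀ Φ (ψ : Edge → Carrier) → (∀ {e z} → Joins e x z → Φ z ≈ ψ e) →
               spread α x ∙ Φ ≈ ∑[ e < ∣E∣ ] when (x ∈ₑ? e) (mass e * ψ e)
    spread-∙ Φ ψ Φ≈ψ = begin
      ∑[ z < ∣V∣ ] (spread α x z * Φ z)
        ≈⟨ sum-cong-≋ vertexwise ⟩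
      ∑[ z < ∣V∣ ] ∑[ e < ∣E∣ ] when (joins? e x z) (mass e * ψ e)
        ≈⟨ ∑-comm (λ z e → when (joins? e x z) (mass e * ψ e)) ⟩
      ∑[ e < ∣E∣ ] ∑[ z < ∣V∣ ] when (joins? e x z) (mass e * ψ e)
        ≈⟨ sum-cong-≋ edgewise ⟩
      ∑[ e < ∣E∣ ] when (x ∈ₑ? e) (mass e * ψ e)  ∎
      where
      vertexwise : ∀ z → spread α x z * Φ z ≈ ∑[ e < ∣E∣ ] when (joins? e x z) (mass e * ψ e)
      vertexwise z with x Fin.≟ z
      ... | yes ≡.refl = trans (zeroˡ _)
        (sym (∑-when-none (λ e → joins? e x x) (λ e → mass e * ψ e) λ _ → joins-irrefl))
      ... | no _ with adjacent? x z
      ...   | yes (e , j) = trans (*-congˡ (Φ≈ψ j))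
        (sym (∑-when-unique (λ e → joins? e x z) (λ e → mass e * ψ e) e j λ k → joins-unique k j))
      ...   | no ¬adj = trans (zeroˡ _)
        (sym (∑-when-none (λ e → joins? e x z) (λ e → mass e * ψ e) λ e j → ¬adj (e , j)))

      edgewise : ∀ e → ∑[ z < ∣V∣ ] when (joins? e x z) (mass e * ψ e) ≈ when (x ∈ₑ? e) (mass e * ψ e)
      edgewise e = ≈-when (x ∈ₑ? e)
        (λ x∈e → let z , j = ∈⇒joins x∈e in
          ∑-when-unique (joins? e x) (λ _ → mass e * ψ e) z j λ k → joins-functional k j)
        (λ x∉e → ∑-when-none (joins? e x) (λ _ → mass e * ψ e) λ z j → x∉e (joins⇒∈ˡ j))

    spread-support : ∀ {z a b} → (∀ {e} → Joins e x z → a ≈ b) → spread α x z * a ≈ spread α x z * b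
    spread-support {z} a≈b with x Fin.≟ z
    ... | yes _ = trans (zeroˡ _) (sym (zeroˡ _))
    ... | no _ with adjacent? x z
    ...   | yes (e , j) = *-congˡ (a≈b j)
    ...   | no _        = trans (zeroˡ _) (sym (zeroˡ _))

    spread-nonneg : α ≤ 1# → ∀ z → 0# ≤ spread α x z
    spread-nonneg α≤1 z with x Fin.≟ z
    ... | yes _ = ≤-refl
    ... | no _ with adjacent? x z
    ...   | yes (e , j) = *-nonneg (0≤y-x α≤1)
      (inj₁ (*-positive (⁻¹-positive (w>0 e)) (⁻¹-positive (D>0 (joins⇒∈ˡ j)))))
    ...   | no _        = ≤-refl

    module _ {e} (x∈e : x ∈ₑ e) where
      private
        D≉0 = pos⇒≉0 (D>0 x∈e)

      spread-total : sum (spread α x) ≈ 1# - α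
      spread-total = begin
        sum (spread α x)
          ≈⟨ sum-cong-≋ (λ z → sym (*-identityʳ (spread α x z))) ⟩
        spread α x ∙ (λ _ → 1#)
          ≈⟨ spread-∙ (λ _ → 1#) (λ _ → 1#) (λ _ → refl) ⟩
        ∑[ g < ∣E∣ ] when (x ∈ₑ? g) (mass g * 1#)
          ≈⟨ sum-cong-≋ (λ g → trans (when-cong (x ∈ₑ? g) (λ _ → rearrange (1# - α) (w g ⁻¹) (D w x ⁻¹)))
                                     (sym (when-*ˡ (x ∈ₑ? g)))) ⟩
        ∑[ g < ∣E∣ ] ((1# - α) / D w x * when (x ∈ₑ? g) (w g ⁻¹))
          ≈⟨ *-distribˡ-sum ((1# - α) / D w x) (λ g → when (x ∈ₑ? g) (w g ⁻¹)) ⟨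
        (1# - α) / D w x * D w x
          ≈⟨ *-assoc _ _ _ ⟩
        (1# - α) * (D w x ⁻¹ * D w x)
          ≈⟨ *-congˡ (*-inverseˡ (D w x) D≉0) ⟩
        (1# - α) * 1#
          ≈⟨ *-identityʳ _ ⟩
        1# - α  ∎
        where
        rearrange : ∀ a u v → a * (u * v) * 1# ≈ a * v * u
        rearrange = solve 3 (λ a u v → a :* (u :* v) :* :1 := a :* v :* u) refl

      -- Each of the `degree x` edges counts 1 and `e` loses 2: this is the origin of d_x - 2 in the
      -- curvature.
      ∑-outward : ∑[ g < ∣E∣ ] when (x ∈ₑ? g) (outward e g) ≈ excess x
      ∑-outward = begin
        ∑[ g < ∣E∣ ] when (x ∈ₑ? g) (outward e g)
          ≈⟨ sum-cong-≋ pointwise ⟩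
        ∑[ g < ∣E∣ ] (when (x ∈ₑ? g) 1# - when (g Fin.≟ e) (1# + 1#))
          ≈⟨ ∑-distrib-‿- (λ g → when (x ∈ₑ? g) 1#) (λ g → when (g Fin.≟ e) (1# + 1#)) ⟩
        ∑[ g < ∣E∣ ] when (x ∈ₑ? g) 1# - ∑[ g < ∣E∣ ] when (g Fin.≟ e) (1# + 1#)
          ≈⟨ +-cong (sym (fromℕ-length-filter (x ∈ₑ?_) id))
                    (-‿cong (trans (∑-when-unique (Fin._≟ e) (λ _ → 1# + 1#) e ≡.refl id)
                                   -- `fromℕ 2` unfolds to `1# + (1# + 0#)`.
                                   (sym (+-congˡ (+-identityʳ 1#))))) ⟩
        excess x  ∎
        where
        subtract : ∀ {P Q : Set} (P? : Dec P) (Q? : Dec Q) → (Q → P) → ∀ a b →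
                   when P? (a - when Q? b) ≈ when P? a - when Q? b
        subtract (yes _) _       _   a b = refl
        subtract (no _)  (no _)  _   a b = sym (-‿inverseʳ 0#)
        subtract (no ¬p) (yes q) q⇒p a b = contradiction (q⇒p q) ¬p

        pointwise : ∀ g → when (x ∈ₑ? g) (outward e g) ≈ when (x ∈ₑ? g) 1# - when (g Fin.≟ e) (1# + 1#)
        pointwise g = subtract (x ∈ₑ? g) (g Fin.≟ e) (λ { ≡.refl → x∈e }) 1# (1# + 1#)

      -- The increment of `Φ` along `g` is `w g` up to sign and the mass sent along `g` is
      -- proportional to `w g ⁻¹`, so the weights cancel and only signs are counted. The sign `ς` is
      -- 1 at the end of `e` where the transport starts and -1 at the other end.
      m-∙ : ∀ Φ ς → (∀ {g z} → Joins g x z → Φ z ≈ Φ x + ς * (outward e g * w g)) →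
            m w α x ∙ Φ ≈ Φ x + ς * ((1# - α) * (excess x / D w x))
      m-∙ Φ ς slope = begin
        m w α x ∙ Φ
          ≈⟨ sum-cong-≋ (λ z → trans (*-congʳ (m≈δ+spread α x z)) (distrib α (δ x z) _ (Φ z))) ⟩
        ∑[ z < ∣V∣ ] (α * (δ x z * Φ z) + spread α x z * Φ z)
          ≈⟨ ∑-distrib-+ (λ z → α * (δ x z * Φ z)) (λ z → spread α x z * Φ z) ⟩
        ∑[ z < ∣V∣ ] (α * (δ x z * Φ z)) + spread α x ∙ Φ
          ≈⟨ +-cong (trans (sym (*-distribˡ-sum α (λ z → δ x z * Φ z))) (*-congˡ (δ-∙ x Φ)))
                    (trans (sum-cong-≋ λ z → solve 3 (λ s p q → s :* p := s :* q :+ s :* (p :- q)) refl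
                                               (spread α x z) (Φ z) (Φ x))
                           (∑-distrib-+ (λ z → spread α x z * Φ x) (λ z → spread α x z * (Φ z - Φ x)))) ⟩
        α * Φ x + (∑[ z < ∣V∣ ] (spread α x z * Φ x) + spread α x ∙ (λ z → Φ z - Φ x))
          ≈⟨ +-congˡ (+-cong (trans (sym (*-distribʳ-sum (Φ x) (spread α x))) (*-congʳ spread-total)) increments) ⟩
        α * Φ x + ((1# - α) * Φ x + ς * ((1# - α) * (excess x / D w x)))
          ≈⟨ solve 3 (λ a p r → a :* p :+ ((:1 :- a) :* p :+ r) := p :+ r) refl α (Φ x) _ ⟩
        Φ x + ς * ((1# - α) * (excess x / D w x))  ∎
        where
        distrib : ∀ a p q r → (a * p + q) * r ≈ a * (p * r) + q * r
        distrib = solve 4 (λ a p q r → (a :* p :+ q) :* r := a :* (p :* r) :+ q :* r) refl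

        increments : spread α x ∙ (λ z → Φ z - Φ x) ≈ ς * ((1# - α) * (excess x / D w x))
        increments = begin
          spread α x ∙ (λ z → Φ z - Φ x)
            ≈⟨ spread-∙ (λ z → Φ z - Φ x) (λ g → ς * (outward e g * w g))
                 (λ j → trans (+-congʳ (slope j)) (solve 2 (λ p r → p :+ r :- p := r) refl (Φ x) _)) ⟩
          ∑[ g < ∣E∣ ] when (x ∈ₑ? g) (mass g * (ς * (outward e g * w g)))
            ≈⟨ sum-cong-≋ (λ g → trans (when-cong (x ∈ₑ? g) (λ _ → cancel g)) (sym (when-*ˡ (x ∈ₑ? g)))) ⟩
          ∑[ g < ∣E∣ ] (ς * ((1# - α) / D w x) * when (x ∈ₑ? g) (outward e g))
            ≈⟨ *-distribˡ-sum (ς * ((1# - α) / D w x)) (λ g → when (x ∈ₑ? g) (outward e g)) ⟨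
          ς * ((1# - α) / D w x) * ∑[ g < ∣E∣ ] when (x ∈ₑ? g) (outward e g)
            ≈⟨ *-congˡ ∑-outward ⟩
          ς * ((1# - α) / D w x) * excess x
            ≈⟨ solve 4 (λ s a v c → s :* (a :* v) :* c := s :* (a :* (c :* v))) refl ς (1# - α) (D w x ⁻¹) (excess x) ⟩
          ς * ((1# - α) * (excess x / D w x))  ∎
          where
          cancel : ∀ g → mass g * (ς * (outward e g * w g)) ≈ ς * ((1# - α) / D w x) * outward e g
          cancel g = begin
            mass g * (ς * (outward e g * w g))
              ≈⟨ solve 6 (λ a u v s o p → a :* (u :* v) :* (s :* (o :* p)) := s :* (a :* v) :* o :* (p :* u)) refl
                   (1# - α) (w g ⁻¹) (D w x ⁻¹) ς (outward e g) (w g) ⟩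
            ς * ((1# - α) / D w x) * outward e g * (w g * w g ⁻¹)
              ≈⟨ *-congˡ (*-inverseʳ (w g) (pos⇒≉0 (w>0 g))) ⟩
            ς * ((1# - α) / D w x) * outward e g * 1#
              ≈⟨ *-identityʳ _ ⟩
            ς * ((1# - α) / D w x) * outward e g  ∎

-- Limits from the left at 1

module LeftLimit {ℓ : Level} (ℝ : CompleteOrderedField ℓ) where
  open CompleteOrderedField ℝ
  open OrderedField ℝ
  open Analysis ℝ
  open Supremum

  lim↑1-eventually : ∀ {g k} → (∀ {α} → ½ ≤ α → α < 1# → g α ≈ k) → lim↑1 g ≈ k
  lim↑1-eventually {g} {k} g≈k = ⨆-singleton tendsto unique
    where
    tendsto : Tendsto↑1 g k
    -- `1# - α < ½` already forces `½ ≤ α`, so one δ serves every ε.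
    tendsto ε 0<ε = ½ , 0<½ , λ α 0≤α α<1 1-α<½ →
      let gα≈k = g≈k (inj₁ (<-diff (0<y-x 1-α<½) (½+[½-[1-α]] α))) α<1
          gα-k≈0 = trans (+-congʳ gα≈k) (-‿inverseʳ k)
          k-gα≈0 = trans (+-congˡ (-‿cong gα≈k)) (-‿inverseʳ k)
      in <-respˡ-≈ (sym gα-k≈0) 0<ε , <-respˡ-≈ (sym k-gα≈0) 0<ε
      where
      ½+[½-[1-α]] : ∀ α → α ≈ ½ + (½ - (1# - α))
      ½+[½-[1-α]] α = trans
        (solve 1 (λ a → a := :1 :- (:1 :- a)) refl α)
        (trans (+-congʳ (sym ½+½)) (+-assoc _ _ _))

    near-1 : ∀ {δ} → 0# < δ → ∃[ α ] (½ ≤ α × α < 1# × 1# - α < δ)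
    near-1 {δ} 0<δ with γ , 0<γ , γ≤δ , γ≤½ ← min-positive 0<δ 0<½ =
      -- Half of a γ that is at most δ and at most ½: the latter keeps α above ½, and halving puts
      -- `1# - α` strictly below δ.
      1# - γ * ½ ,
      ≤-respʳ (+-congʳ ½+½) (≤-diff (0≤y-x (≤-trans (inj₁ (half<self 0<γ)) γ≤½))
        (solve 2 (λ h t → h :+ h :- t := h :+ (h :- t)) refl ½ (γ * ½))) ,
      <-diff (*-positive 0<γ 0<½) (solve 1 (λ t → :1 := :1 :- t :+ t) refl (γ * ½)) ,
      <-respˡ-≈ (solve 1 (λ t → t := :1 :- (:1 :- t)) refl (γ * ½))
        (<-≤-trans (half<self 0<γ) γ≤δ)

    unique : ∀ {r} → Tendsto↑1 g r → r ≈ k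
    unique {r} tends with compare r k
    ... | tri≈ _ r≈k _ = r≈k
    -- With the distance of `r` and `k` as tolerance, any α where `g α ≈ k` yields a number smaller
    -- than itself.
    ... | tri< r<k _ _ with δ , 0<δ , close ← tends (k - r) (0<y-x r<k)
      with α , ½≤α , α<1 , 1-α<δ ← near-1 0<δ =
        contradiction (proj₁ (close α (≤-trans (inj₁ 0<½) ½≤α) α<1 1-α<δ))
          (irrefl (+-congʳ (g≈k ½≤α α<1)))
    unique {r} tends | tri> _ _ k<r with δ , 0<δ , close ← tends (r - k) (0<y-x k<r)
      with α , ½≤α , α<1 , 1-α<δ ← near-1 0<δ =
        contradiction (proj₂ (close α (≤-trans (inj₁ 0<½) ½≤α) α<1 1-α<δ))
          (irrefl (+-congˡ (-‿cong (g≈k ½≤α α<1))))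

-- Optimal transport across one edge and the curvature formula

module LinLuYau {ℓ : Level} (ℝ : CompleteOrderedField ℓ) (T : Tree)
                (w : Curvature.Weight ℝ T) (w>0 : Curvature.Positive ℝ T w) where
  open CompleteOrderedField ℝ
  open Tree T
  open Curvature ℝ T
  open OrderedField ℝ
  open LinearAlgebra ℝ
  open FiniteSums ℝ
  open LeftLimit ℝ
  open DegreeExcess ℝ graph
  open Transport ℝ T w w>0
  open PotentialTheory ℝ T
  open import Relation.Binary.Reasoning.Setoid setoid

  module _ (e : Edge) where
    private
      x y : Vertex
      x = lo e
      y = hi e

      x∈e : x ∈ₑ e
      x∈e = inj₁ ≡.refl

      y∈e : y ∈ₑ e
      y∈e = inj₂ ≡.refl

      e-joins : Joins e x y
      e-joins = inj₁ (≡.refl , ≡.refl)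

    -- The stored orientation of such an edge runs against the transport, out of `x` or into `y`.
    -- The edge `e` also passes this test, so `θ` has to single it out first.
    towards : (g : Edge) → Dec (lo g ≡ x ⊎ hi g ≡ y)
    towards g = (lo g Fin.≟ x) ⊎-dec (hi g Fin.≟ y)

    -- The edges other than e that meet e are directed along the transport
    -- from x to y, so that the potential is calibrated by its geodesics.
    θ : Edge → Carrier
    θ g = orient (g Fin.≟ e) (towards g) (w g)
      where
      orient : ∀ {P Q : Set} → Dec P → Dec Q → Carrier → Carrier
      orient (yes _) _       a = a
      orient (no _)  (yes _) a = - a
      orient (no _)  (no _)  a = a

    θ-self : θ e ≈ w e
    θ-self with e Fin.≟ e
    ... | yes _  = refl
    ... | no e≢e = contradiction ≡.refl e≢e

    θ-negative : ∀ {g} → g ≢ e → lo g ≡ x ⊎ hi g ≡ y → θ g ≈ - w g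
    θ-negative {g} g≢e t with g Fin.≟ e | towards g
    ... | yes g≡e | _      = contradiction g≡e g≢e
    ... | no _    | yes _  = refl
    ... | no _    | no ¬t  = contradiction t ¬t

    θ-positive : ∀ {g} → ¬ (lo g ≡ x ⊎ hi g ≡ y) → θ g ≈ w g
    θ-positive {g} ¬t with g Fin.≟ e | towards g
    ... | yes _ | _     = refl
    ... | no _  | yes t = contradiction t ¬t
    ... | no _  | no _  = refl

    θ-bounded : ∀ g → θ g ≤ w g × - θ g ≤ w g
    θ-bounded g with g Fin.≟ e | towards g
    ... | yes _ | _     = ≤-refl , -x≤x (w>0 g)
    ... | no _  | no _  = ≤-refl , -x≤x (w>0 g)
    ... | no _  | yes _ = -x≤x (w>0 g) , inj₂ (solve 1 (λ a → :- (:- a) := a) refl (w g))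

    ∫-≤-length : ∀ {u v} (p : Walk u v) → ∫ θ p ≤ walkLength w p
    ∫-≤-length []                  = ≤-refl
    ∫-≤-length (step g (inj₁ _) p) = +-mono-≤ (proj₁ (θ-bounded g)) (∫-≤-length p)
    ∫-≤-length (step g (inj₂ _) p) = +-mono-≤ (proj₂ (θ-bounded g)) (∫-≤-length p)

    Φ : Vertex → Carrier
    Φ = potential θ x

    -- Since `θ` lies between `- w` and `w`, its integral along any walk is at most the length of
    -- that walk, and this passes to the infimum over walks.
    Φ-lipschitz : ∀ u v → Φ u - Φ v ≤ d u v
    Φ-lipschitz u v = pathMetric-greatest λ p →
      ≤-respˡ (sym (trans (+-congʳ (potential-walk θ x p))
                          (solve 2 (λ a b → a :+ b :- b := a) refl (∫ θ p) (Φ v))))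
              (∫-≤-length p)

    Φ-e : Φ x ≈ w e + Φ y
    Φ-e = trans (potential-step θ x e-joins) (+-congʳ θ-self)

    Φ-x : ∀ {g z} → g ≢ e → Joins g x z → Φ z ≈ w g + Φ x
    Φ-x {g} {z} g≢e j = trans (potential-step θ x (joins-sym j)) (+-congʳ (value j))
      where
      value : ∀ j → along θ {g} {z} {x} (joins-sym j) ≈ w g
      value (inj₁ (lo≡x , _)) = trans (-‿cong (θ-negative g≢e (inj₁ lo≡x)))
        (solve 1 (λ a → :- (:- a) := a) refl (w g))
      value (inj₂ (_ , hi≡x)) = θ-positive λ where
        (inj₁ lo≡x) → lo≢hi g (≡.trans lo≡x (≡.sym hi≡x))
        (inj₂ hi≡y) → lo≢hi e (≡.trans (≡.sym hi≡x) hi≡y)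

    Φ-y : ∀ {g z} → g ≢ e → Joins g y z → Φ y ≈ w g + Φ z
    Φ-y {g} {z} g≢e j = trans (potential-step θ x j) (+-congʳ (value j))
      where
      value : ∀ j → along θ {g} {y} {z} j ≈ w g
      value (inj₂ (_ , hi≡y)) = trans (-‿cong (θ-negative g≢e (inj₂ hi≡y)))
        (solve 1 (λ a → :- (:- a) := a) refl (w g))
      value (inj₁ (lo≡y , _)) = θ-positive λ where
        (inj₁ lo≡x) → lo≢hi e (≡.trans (≡.sym lo≡x) lo≡y)
        (inj₂ hi≡y) → lo≢hi g (≡.trans lo≡y (≡.sym hi≡y))

    Φ-slope-x : ∀ {g z} → Joins g x z → Φ z ≈ Φ x + 1# * (outward e g * w g)
    Φ-slope-x {g} {z} j with g Fin.≟ e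
    ... | no g≢e = trans (Φ-x g≢e j)
      (solve 2 (λ a p → a :+ p := p :+ :1 :* ((:1 :- :0) :* a)) refl (w g) (Φ x))
    ... | yes ≡.refl with ≡.refl ← joins-functional j e-joins = trans
      (solve 2 (λ a p → p := a :+ p :+ :1 :* ((:1 :- (:1 :+ :1)) :* a)) refl (w e) (Φ y))
      (+-congʳ (sym Φ-e))

    Φ-slope-y : ∀ {g z} → Joins g y z → Φ z ≈ Φ y + (- 1#) * (outward e g * w g)
    Φ-slope-y {g} {z} j with g Fin.≟ e
    ... | no g≢e = trans
      (solve 2 (λ a p → p := a :+ p :+ (:- :1) :* ((:1 :- :0) :* a)) refl (w g) (Φ z))
      (+-congʳ (sym (Φ-y g≢e j)))
    ... | yes ≡.refl with ≡.refl ← joins-functional j (joins-sym e-joins) = trans Φ-e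
      (solve 2 (λ a p → a :+ p := p :+ (:- :1) :* ((:1 :- (:1 :+ :1)) :* a)) refl (w e) (Φ y))

    -- `Φ-lipschitz` bounds the distance from below by the same number, so one walk of the right
    -- length settles it and shortest paths need not be characterised.
    calibrated : ∀ {u v} (p : Walk u v) → walkLength w p ≈ Φ u - Φ v → d u v ≈ Φ u - Φ v
    calibrated p tight = ≤-antisym (≤-respʳ tight (pathMetric-upper p)) (Φ-lipschitz _ _)

    d-xy : d x y ≈ Φ x - Φ y
    d-xy = calibrated (step e e-joins []) (trans
      (solve 2 (λ a p → a :+ :0 := a :+ p :- p) refl (w e) (Φ y))
      (+-congʳ (sym Φ-e)))

    d-self : ∀ u → d u u ≈ Φ u - Φ u
    d-self u = calibrated [] (sym (-‿inverseʳ (Φ u)))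

    d-to-y : ∀ {g u} → Joins g x u → d u y ≈ Φ u - Φ y
    d-to-y {g} {u} j with g Fin.≟ e
    ... | no g≢e = calibrated (step g (joins-sym j) (step e e-joins [])) (trans
      (solve 3 (λ a b p → a :+ (b :+ :0) := a :+ (b :+ p) :- p) refl (w g) (w e) (Φ y))
      (+-congʳ (sym (trans (Φ-x g≢e j) (+-congˡ Φ-e)))))
    -- Here `u` is `y`: this mass is already in place, and the empty walk is the witness.
    ... | yes ≡.refl with ≡.refl ← joins-functional j e-joins = d-self y

    d-from-x : ∀ {g v} → Joins g y v → d x v ≈ Φ x - Φ v
    d-from-x {g} {v} j with g Fin.≟ e
    ... | no g≢e = calibrated (step e e-joins (step g j [])) (trans
      (solve 3 (λ a b p → b :+ (a :+ :0) := b :+ (a :+ p) :- p) refl (w g) (w e) (Φ v))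
      (+-congʳ (sym (trans Φ-e (+-congˡ (Φ-y g≢e j))))))
    ... | yes ≡.refl with ≡.refl ← joins-functional j (joins-sym e-joins) = d-self x

    module _ {α} (½≤α : ½ ≤ α) (α<1 : α < 1#) where
      private
        σ τ : Vector Carrier ∣V∣
        σ = spread α x
        τ = spread α y

        -- Of the mass α at `x`, an amount 1 - α is used for the spread around `y`. What is left, 2α
        -- - 1, is nonnegative exactly when α ≥ 1/2, whence the threshold.
        rest : Carrier
        rest = α + α - 1#

      -- Everything that has left x goes to y, everything that is to spread
      -- around y comes from x, and the rest goes from x to y.
      plan : Vertex → Vertex → Carrier
      plan u v = σ u * δ y v + δ x u * τ v + rest * (δ x u * δ y v)

      private
        δ-total : ∀ z → sum (δ z) ≈ 1#
        δ-total z = ∑-when-unique (z Fin.≟_) (λ _ → 1#) z ≡.refl ≡.sym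

        δ-nonneg : ∀ z v → 0# ≤ δ z v
        δ-nonneg z v = when-nonneg (z Fin.≟ v) λ _ → inj₁ 0<1

        -- Rows and columns of `plan` share this shape: `f` and `g` are `δ y` and `τ` for the left
        -- marginal, `δ x` and `σ` for the right one.
        combination : ∀ a b c (f g : Vector Carrier ∣V∣) {s t} → sum f ≈ s → sum g ≈ t →
          ∑[ v < ∣V∣ ] (a * f v + b * g v + c * f v) ≈ a * s + b * t + c * s
        combination a b c f g ∑f ∑g = trans
          (∑-distrib-+ (λ v → a * f v + b * g v) (λ v → c * f v))
          (+-cong (trans (∑-distrib-+ (λ v → a * f v) (λ v → b * g v))
                         (+-cong (trans (sym (*-distribˡ-sum a f)) (*-congˡ ∑f))
                                 (trans (sym (*-distribˡ-sum b g)) (*-congˡ ∑g))))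
                  (trans (sym (*-distribˡ-sum c f)) (*-congˡ ∑f)))

      plan-coupling : IsCoupling (m w α x) (m w α y) plan
      plan-coupling = record
        { nonneg = λ u v → +-nonneg
            (+-nonneg (*-nonneg (spread-nonneg α x (inj₁ α<1) u) (δ-nonneg y v))
                      (*-nonneg (δ-nonneg x u) (spread-nonneg α y (inj₁ α<1) v)))
            (*-nonneg rest-nonneg (*-nonneg (δ-nonneg x u) (δ-nonneg y v)))
        ; marginalˡ = λ u → begin
            ∑[ v < ∣V∣ ] plan u v
              ≈⟨ sum-cong-≋ (λ v → +-congˡ (sym (*-assoc rest (δ x u) (δ y v)))) ⟩
            ∑[ v < ∣V∣ ] (σ u * δ y v + δ x u * τ v + rest * δ x u * δ y v)
              ≈⟨ combination (σ u) (δ x u) (rest * δ x u) (δ y) τ (δ-total y) (spread-total α y y∈e) ⟩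
            σ u * 1# + δ x u * (1# - α) + rest * δ x u * 1#
              ≈⟨ solve 3 (λ a s p → s :* :1 :+ p :* (:1 :- a) :+ (a :+ a :- :1) :* p :* :1 := a :* p :+ s)
                   refl α (σ u) (δ x u) ⟩
            α * δ x u + σ u
              ≈⟨ m≈δ+spread α x u ⟨
            m w α x u  ∎
        ; marginalʳ = λ v → begin
            ∑[ u < ∣V∣ ] plan u v
              ≈⟨ sum-cong-≋ (λ u → solve 5 (λ s t p q r → s :* q :+ p :* t :+ r :* (p :* q) := t :* p :+ q :* s :+ r :* q :* p)
                   refl (σ u) (τ v) (δ x u) (δ y v) rest) ⟩
            ∑[ u < ∣V∣ ] (τ v * δ x u + δ y v * σ u + rest * δ y v * δ x u)
              ≈⟨ combination (τ v) (δ y v) (rest * δ y v) (δ x) σ (δ-total x) (spread-total α x x∈e) ⟩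
            τ v * 1# + δ y v * (1# - α) + rest * δ y v * 1#
              ≈⟨ solve 3 (λ a s p → s :* :1 :+ p :* (:1 :- a) :+ (a :+ a :- :1) :* p :* :1 := a :* p :+ s)
                   refl α (τ v) (δ y v) ⟩
            α * δ y v + τ v
              ≈⟨ m≈δ+spread α y v ⟨
            m w α y v  ∎
        }
        where
        rest-nonneg : 0# ≤ rest
        rest-nonneg = ≤-respʳ (+-congˡ (-‿cong ½+½)) (≤-respʳ
          (solve 2 (λ a h → a :- h :+ (a :- h) := a :+ a :- (h :+ h)) refl α ½)
          (+-nonneg (0≤y-x ½≤α) (0≤y-x ½≤α)))

      -- In the first two summands a `δ` fixes one end and `spread-support` makes the other a
      -- neighbour of the opposite end of `e`; in the third both ends are fixed. This leaves just
      -- the pairs covered by `d-to-y`, `d-from-x` and `d-xy`.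
      plan-slack : ∀ u v → plan u v * d u v ≈ plan u v * (Φ u - Φ v)
      plan-slack u v = begin
        plan u v * d u v
          ≈⟨ expand (σ u) (τ v) (δ x u) (δ y v) rest (d u v) ⟩
        δ y v * (σ u * d u v) + δ x u * (τ v * d u v) + rest * (δ x u * (δ y v * d u v))
          ≈⟨ +-cong (+-cong
               (at y v λ { ≡.refl → spread-support α x d-to-y })
               (at x u λ { ≡.refl → spread-support α y d-from-x }))
               (*-congˡ (at x u λ { ≡.refl → at y v λ { ≡.refl → d-xy } })) ⟩
        δ y v * (σ u * (Φ u - Φ v)) + δ x u * (τ v * (Φ u - Φ v)) + rest * (δ x u * (δ y v * (Φ u - Φ v)))
          ≈⟨ expand (σ u) (τ v) (δ x u) (δ y v) rest (Φ u - Φ v) ⟨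
        plan u v * (Φ u - Φ v)  ∎
        where
        expand : ∀ s t p q r c → (s * q + p * t + r * (p * q)) * c ≈ q * (s * c) + p * (t * c) + r * (p * (q * c))
        expand = solve 6 (λ s t p q r c → (s :* q :+ p :* t :+ r :* (p :* q)) :* c
                                       := q :* (s :* c) :+ p :* (t :* c) :+ r :* (p :* (q :* c))) refl

        at : ∀ z v {a b} → (z ≡ v → a ≈ b) → δ z v * a ≈ δ z v * b
        at z v a≈b = trans (when-*ʳ (z Fin.≟ v)) (trans
          (when-cong (z Fin.≟ v) λ z≡v → *-congˡ (a≈b z≡v)) (sym (when-*ʳ (z Fin.≟ v))))

      W₁-formula : W₁ w (m w α x) (m w α y) ≈
                   w e + (1# - α) * (excess x / D w x + excess y / D w y)
      W₁-formula = begin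
        W₁ w (m w α x) (m w α y)
          ≈⟨ W₁-optimal Φ Φ-lipschitz plan-coupling plan-slack ⟩
        m w α x ∙ Φ - m w α y ∙ Φ
          ≈⟨ +-cong (m-∙ α x x∈e Φ 1# Φ-slope-x) (-‿cong (m-∙ α y y∈e Φ (- 1#) Φ-slope-y)) ⟩
        (Φ x + 1# * ((1# - α) * (excess x / D w x))) - (Φ y + (- 1#) * ((1# - α) * (excess y / D w y)))
          ≈⟨ +-congʳ (+-congʳ Φ-e) ⟩
        (w e + Φ y + 1# * ((1# - α) * (excess x / D w x))) - (Φ y + (- 1#) * ((1# - α) * (excess y / D w y)))
          ≈⟨ solve 5 (λ l p t a b → (l :+ p :+ :1 :* (t :* a)) :- (p :+ (:- :1) :* (t :* b)) := l :+ t :* (a :+ b))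
               refl (w e) (Φ y) (1# - α) (excess x / D w x) (excess y / D w y) ⟩
        w e + (1# - α) * (excess x / D w x + excess y / D w y)  ∎

  -- The leading `w e` of `W₁` cancels the 1, and the factor 1 - α cancels the denominator, so the
  -- quotient is constant on [1/2, 1).
  κ-formula : ∀ e → κ w e ≈ - (w e ⁻¹ * (excess (lo e) / D w (lo e) + excess (hi e) / D w (hi e)))
  κ-formula e = lim↑1-eventually λ {α} ½≤α α<1 → begin
    (1# - W₁ w (m w α (lo e)) (m w α (hi e)) / w e) / (1# - α)
      ≈⟨ *-congʳ (+-congˡ (-‿cong (*-congʳ (W₁-formula e ½≤α α<1)))) ⟩
    (1# - (w e + (1# - α) * b) / w e) / (1# - α)
      ≈⟨ solve 5 (λ l t b i j → (:1 :- (l :+ t :* b) :* i) :* j := (:1 :- l :* i) :* j :- t :* j :* (i :* b))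
           refl (w e) (1# - α) b (w e ⁻¹) ((1# - α) ⁻¹) ⟩
    (1# - w e / w e) / (1# - α) - (1# - α) / (1# - α) * (w e ⁻¹ * b)
      ≈⟨ +-cong (*-congʳ (+-congˡ (-‿cong (*-inverseʳ _ (pos⇒≉0 (w>0 e))))))
                (-‿cong (*-congʳ (*-inverseʳ _ (pos⇒≉0 (0<y-x α<1))))) ⟩
    (1# - 1#) / (1# - α) - 1# * (w e ⁻¹ * b)
      ≈⟨ solve 2 (λ j c → (:1 :- :1) :* j :- :1 :* c := :- c) refl ((1# - α) ⁻¹) (w e ⁻¹ * b) ⟩
    - (w e ⁻¹ * b)  ∎
    where
    b : Carrier
    b = excess (lo e) / D w (lo e) + excess (hi e) / D w (hi e)

-- Limits and derivatives relative to a set of times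

module Calculus {ℓ : Level} (ℝ : CompleteOrderedField ℓ)
                (I : Pred (CompleteOrderedField.Carrier ℝ) ℓ)
                (t : CompleteOrderedField.Carrier ℝ) where
  open CompleteOrderedField ℝ
  open OrderedField ℝ
  open LinearAlgebra ℝ
  open Analysis ℝ
  open import Relation.Binary.Reasoning.Setoid setoid

  Eventually : Pred Carrier ℓ → Set ℓ
  Eventually P = ∃[ δ ] (0# < δ × (∀ s → I s → ¬ (s ≈ t) → ∣ s - t ∣< δ → P s))

  -- Punctured at `t`, so that `HasDerivative I g t g′` unfolds to a `Lim` of difference quotients
  -- and rules for limits apply to derivatives directly.
  Lim : (Carrier → Carrier) → Carrier → Set ℓ
  Lim h L = ∀ ε → 0# < ε → Eventually λ s → ∣ h s - L ∣< ε

  infix 4 _≋_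
  _≋_ : (g h : Carrier → Carrier) → Set ℓ
  g ≋ h = ∀ s → I s → ¬ (s ≈ t) → g s ≈ h s

  eventually-map : ∀ {P Q} → (∀ s → I s → ¬ (s ≈ t) → P s → Q s) → Eventually P → Eventually Q
  eventually-map P⇒Q (δ , 0<δ , P-near) =
    δ , 0<δ , λ s Is s≉t near → P⇒Q s Is s≉t (P-near s Is s≉t near)

  eventually-× : ∀ {P Q} → Eventually P → Eventually Q → Eventually λ s → P s × Q s
  eventually-× (δ , 0<δ , P-near) (η , 0<η , Q-near) with γ , 0<γ , γ≤δ , γ≤η ← min-positive 0<δ 0<η =
    γ , 0<γ , λ s Is s≉t (l , r) →
      P-near s Is s≉t (<-≤-trans l γ≤δ , <-≤-trans r γ≤δ) ,
      Q-near s Is s≉t (<-≤-trans l γ≤η , <-≤-trans r γ≤η)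

  near-cong : ∀ {x x′ y y′ ε} → x - y ≈ x′ - y′ → ∣ x - y ∣< ε → ∣ x′ - y′ ∣< ε
  near-cong {x} {x′} {y} {y′} eq (l , r) = <-respˡ-≈ eq l , <-respˡ-≈ (begin
    y - x        ≈⟨ flip y x ⟩
    - (x - y)    ≈⟨ -‿cong eq ⟩
    - (x′ - y′)  ≈⟨ flip y′ x′ ⟨
    y′ - x′      ∎) r
    where
    flip : ∀ a b → a - b ≈ - (b - a)
    flip = solve 2 (λ a b → a :- b := :- (b :- a)) refl

  lim-shift : ∀ {g h K L} → (∀ s → I s → ¬ (s ≈ t) → g s - K ≈ h s - L) → Lim g K → Lim h L
  lim-shift eq lim ε 0<ε = eventually-map (λ s Is s≉t → near-cong (eq s Is s≉t)) (lim ε 0<ε)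

  lim-cong : ∀ {g h K L} → g ≋ h → K ≈ L → Lim g K → Lim h L
  lim-cong g≋h K≈L = lim-shift λ s Is s≉t → +-cong (g≋h s Is s≉t) (-‿cong K≈L)

  lim-const : ∀ c → Lim (λ _ → c) c
  lim-const c ε 0<ε = 1# , 0<1 , λ _ _ _ _ →
    <-respˡ-≈ (sym (-‿inverseʳ c)) 0<ε , <-respˡ-≈ (sym (-‿inverseʳ c)) 0<ε

  lim-+ : ∀ {g h K L} → Lim g K → Lim h L → Lim (λ s → g s + h s) (K + L)
  lim-+ {g} {h} {K} {L} limg limh ε 0<ε =
    eventually-map (λ s _ _ ((a , b) , (c , d)) → join (g s) K (h s) L a c , join K (g s) L (h s) b d)
      (eventually-× (limg (ε * ½) 0<ε½) (limh (ε * ½) 0<ε½))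
    where
    0<ε½ : 0# < ε * ½
    0<ε½ = *-positive 0<ε 0<½

    join : ∀ a b c d → a - b < ε * ½ → c - d < ε * ½ → (a + c) - (b + d) < ε
    join a b c d p q = <-respʳ-≈ (trans (sym (distribˡ ε ½ ½)) (trans (*-congˡ ½+½) (*-identityʳ ε)))
      (<-respˡ-≈ (solve 4 (λ a b c d → (a :- b) :+ (c :- d) := (a :+ c) :- (b :+ d)) refl a b c d)
        (+-mono-< p q))

  -- Closeness is a pair of one-sided bounds. The upper bound on a product is enough: for `- x` and
  -- `y` it gives the lower one.
  near-* : ∀ {x y ε η} → ∣ x - 0# ∣< ε → ∣ y - 0# ∣< η → ∣ x * y - 0# ∣< ε * η
  near-* {x} {y} {ε} {η} (x<ε , -x<ε) (y<η , -y<η) = product x y x<ε -x<ε y<η -y<η ,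
    <-respˡ-≈ (solve 2 (λ x y → (:- x) :* y :- :0 := :0 :- x :* y) refl x y)
      (product (- x) y (<-respˡ-≈ (flip₁ x) -x<ε) (<-respˡ-≈ (flip₂ x) x<ε) y<η -y<η)
    where
    flip₁ : ∀ x → 0# - x ≈ - x - 0#
    flip₁ = solve 1 (λ x → :0 :- x := :- x :- :0) refl
    flip₂ : ∀ x → x - 0# ≈ 0# - - x
    flip₂ = solve 1 (λ x → x :- :0 := :0 :- (:- x)) refl

    -- (ε - x)(η + y) + (ε + x)(η - y) = 2(εη - xy)
    product : ∀ x y → x - 0# < ε → 0# - x < ε → y - 0# < η → 0# - y < η → x * y - 0# < ε * η
    product x y p q r s = <-diff
      (*-positive 0<½ (+-pos (*-positive (0<y-x p) (0<y-x s)) (*-positive (0<y-x q) (0<y-x r)))) (begin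
        ε * η
          ≈⟨ solve 2 (λ c z → c := z :- :0 :+ :1 :* (c :- z)) refl (ε * η) (x * y) ⟩
        x * y - 0# + 1# * (ε * η - x * y)
          ≈⟨ +-congˡ (*-congʳ ½+½) ⟨
        x * y - 0# + (½ + ½) * (ε * η - x * y)
          ≈⟨ solve 5 (λ h e n x y → x :* y :- :0 :+ (h :+ h) :* (e :* n :- x :* y) :=
               x :* y :- :0 :+ h :* ((e :- (x :- :0)) :* (n :- (:0 :- y)) :+ (e :- (:0 :- x)) :* (n :- (y :- :0))))
               refl ½ ε η x y ⟩
        x * y - 0# + ½ * ((ε - (x - 0#)) * (η - (0# - y)) + (ε - (0# - x)) * (η - (y - 0#)))  ∎)

  null-*-bounded : ∀ {g B} (h : Carrier → Carrier) → 0# < B → Lim g 0# → Eventually (λ s → ∣ h s - 0# ∣< B) →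
                   Lim (λ s → g s * h s) 0#
  null-*-bounded {g} {B} h 0<B g→0 h-bounded ε 0<ε =
    eventually-map (λ s _ _ (p , q) →
        let l , r = near-* {g s} {h s} p q in <-respʳ-≈ cancel l , <-respʳ-≈ cancel r)
      (eventually-× (g→0 (ε / B) (*-positive 0<ε (⁻¹-positive 0<B))) h-bounded)
    where
    cancel : ε / B * B ≈ ε
    cancel = trans (*-assoc _ _ _) (trans (*-congˡ (*-inverseˡ B (pos⇒≉0 0<B))) (*-identityʳ ε))

  null-*ʳ : ∀ {g} c → Lim g 0# → Lim (λ s → g s * c) 0#
  null-*ʳ {g} c g→0 = null-*-bounded (λ _ → c) 0<bound g→0 (1# , 0<1 , λ _ _ _ _ → c<bound , -c<bound)
    where
    bound : Carrier
    bound = 1# + c * c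

    -- 1 + c² ∓ c = (c ∓ ½)² + ½ (1 + ½), for both signs of c.
    below : ∀ c → c < 1# + c * c
    below c = <-diff (+-pos-nonneg (*-positive 0<½ (+-pos 0<1 0<½)) (square-nonneg (c - ½))) (begin
      1# + c * c
        ≈⟨ solve 1 (λ c → :1 :+ c :* c := c :+ (:1 :- :1 :* c :+ c :* c)) refl c ⟩
      c + (1# - 1# * c + c * c)
        -- ½ is only a variable to the solver, so 1 is replaced by `½ + ½` wherever the completed
        -- square needs it.
        ≈⟨ +-congˡ (+-congʳ (+-cong (sym ½+½) (-‿cong (*-congʳ (sym ½+½))))) ⟩
      c + (½ + ½ - (½ + ½) * c + c * c)
        ≈⟨ +-congˡ (+-congʳ (+-congʳ (+-congˡ (trans (sym (*-identityʳ ½)) (*-congˡ (sym ½+½)))))) ⟩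
      c + (½ + ½ * (½ + ½) - (½ + ½) * c + c * c)
        ≈⟨ solve 2 (λ c h → c :+ (h :+ h :* (h :+ h) :- (h :+ h) :* c :+ c :* c) :=
                            c :+ (h :* (:1 :+ h) :+ (c :- h) :* (c :- h))) refl c ½ ⟩
      c + (½ * (1# + ½) + (c - ½) * (c - ½))  ∎)

    0<bound : 0# < bound
    0<bound = +-pos-nonneg 0<1 (square-nonneg c)

    c<bound : c - 0# < bound
    c<bound = <-respˡ-≈ (solve 1 (λ c → c := c :- :0) refl c) (below c)

    -c<bound : 0# - c < bound
    -c<bound = <-respʳ-≈ (solve 1 (λ c → :1 :+ (:0 :- c) :* (:0 :- c) := :1 :+ c :* c) refl c) (below (0# - c))

  lim⇒null : ∀ {g K} → Lim g K → Lim (λ s → g s - K) 0#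
  lim⇒null {g} {K} = lim-shift λ s _ _ → solve 2 (λ a b → a :- b := a :- b :- :0) refl (g s) K

  null⇒lim : ∀ {g K} → Lim (λ s → g s - K) 0# → Lim g K
  null⇒lim {g} {K} = lim-shift λ s _ _ → solve 2 (λ a b → a :- b :- :0 := a :- b) refl (g s) K

  -- gh - KL = (g - K)(h - L) + (g - K)L + (h - L)K, where every summand has one null and one
  -- bounded factor.
  lim-* : ∀ {g h K L} → Lim g K → Lim h L → Lim (λ s → g s * h s) (K * L)
  lim-* {g} {h} {K} {L} limg limh = null⇒lim (lim-cong
    (λ s _ _ → solve 4 (λ g h k l → (g :- k) :* (h :- l) :+ ((g :- k) :* l :+ (h :- l) :* k) := g :* h :- k :* l)
                 refl (g s) (h s) K L)
    (trans (+-identityˡ _) (+-identityˡ _))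
    (lim-+ (null-*-bounded (λ s → h s - L) 0<1 (lim⇒null limg) (lim⇒null limh 1# 0<1))
           (lim-+ (null-*ʳ L (lim⇒null limg)) (null-*ʳ K (lim⇒null limh)))))

  -- 1/g - 1/K = (g - K)(-1/K)(1/g). As soon as g > K/2 the last factor lies below 2/K, which is the
  -- bound `B`.
  lim-⁻¹ : ∀ {g K} → Lim g K → 0# < K → (∀ s → I s → 0# < g s) → Lim (λ s → g s ⁻¹) (K ⁻¹)
  lim-⁻¹ {g} {K} limg 0<K g>0 = null⇒lim (lim-cong
    (λ s Is _ → begin
      (g s - K) * - K ⁻¹ * g s ⁻¹
        ≈⟨ solve 4 (λ g k a b → (g :- k) :* (:- b) :* a := k :* b :* a :- g :* a :* b) refl (g s) K (g s ⁻¹) (K ⁻¹) ⟩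
      K / K * g s ⁻¹ - g s / g s * K ⁻¹
        ≈⟨ +-cong (*-congʳ (*-inverseʳ K (pos⇒≉0 0<K)))
                  (-‿cong (*-congʳ (*-inverseʳ (g s) (pos⇒≉0 (g>0 s Is))))) ⟩
      1# * g s ⁻¹ - 1# * K ⁻¹
        ≈⟨ +-cong (*-identityˡ _) (-‿cong (*-identityˡ _)) ⟩
      g s ⁻¹ - K ⁻¹  ∎)
    refl
    (null-*-bounded (λ s → g s ⁻¹) 0<B (null-*ʳ (- K ⁻¹) (lim⇒null limg))
      (eventually-map bounded (limg (K * ½) (*-positive 0<K 0<½)))))
    where
    B : Carrier
    B = K ⁻¹ + K ⁻¹

    0<B : 0# < B
    0<B = +-pos (⁻¹-positive 0<K) (⁻¹-positive 0<K)

    bounded : ∀ s → I s → ¬ (s ≈ t) → ∣ g s - K ∣< K * ½ → ∣ g s ⁻¹ - 0# ∣< B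
    bounded s Is _ (_ , K-g<K½) =
      -- 2/K - 1/g = (2g - K)/(gK), with 2g - K written as twice K/2 - (K - g), which is positive in
      -- the chosen neighbourhood.
      <-diff (*-positive (*-positive (+-pos 0<r 0<r) (⁻¹-positive (g>0 s Is))) (⁻¹-positive 0<K)) (begin
        K ⁻¹ + K ⁻¹
          ≈⟨ solve 2 (λ a b → b :+ b := a :- :0 :+ ((:1 :+ :1) :* b :- :1 :* a)) refl (g s ⁻¹) (K ⁻¹) ⟩
        g s ⁻¹ - 0# + ((1# + 1#) * K ⁻¹ - 1# * g s ⁻¹)
          ≈⟨ +-congˡ (+-cong (*-congʳ (+-cong (sym ga≈1) (sym ga≈1))) (-‿cong (*-congʳ (sym Kb≈1)))) ⟩
        g s ⁻¹ - 0# + ((g s / g s + g s / g s) * K ⁻¹ - K / K * g s ⁻¹)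
          ≈⟨ solve 4 (λ g k a b → a :- :0 :+ ((g :* a :+ g :* a) :* b :- k :* b :* a) :=
                                  a :- :0 :+ (k :* :1 :- (k :- g) :- (k :- g)) :* a :* b)
               refl (g s) K (g s ⁻¹) (K ⁻¹) ⟩
        g s ⁻¹ - 0# + (K * 1# - (K - g s) - (K - g s)) * g s ⁻¹ * K ⁻¹
          ≈⟨ +-congˡ (*-congʳ (*-congʳ (+-congʳ (+-congʳ (*-congˡ ½+½))))) ⟨
        g s ⁻¹ - 0# + (K * (½ + ½) - (K - g s) - (K - g s)) * g s ⁻¹ * K ⁻¹
          ≈⟨ +-congˡ (*-congʳ (*-congʳ (solve 3 (λ k h c → k :* (h :+ h) :- c :- c := (k :* h :- c) :+ (k :* h :- c))
                                          refl K ½ (K - g s)))) ⟩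
        g s ⁻¹ - 0# + (K * ½ - (K - g s) + (K * ½ - (K - g s))) * g s ⁻¹ * K ⁻¹  ∎) ,
      <-diff (+-pos 0<B (⁻¹-positive (g>0 s Is)))
        (solve 2 (λ a b → b := (:0 :- a) :+ (b :+ a)) refl (g s ⁻¹) B)
      where
      0<r : 0# < K * ½ - (K - g s)
      0<r = 0<y-x K-g<K½
      ga≈1 = *-inverseʳ (g s) (pos⇒≉0 (g>0 s Is))
      Kb≈1 = *-inverseʳ K (pos⇒≉0 0<K)

  slope : (Carrier → Carrier) → Carrier → Carrier
  slope g s = (g s - g t) / (s - t)

  s-t≉0 : ∀ {s} → ¬ (s ≈ t) → ¬ (s - t ≈ 0#)
  s-t≉0 {s} s≉t s-t≈0 = s≉t (begin
    s          ≈⟨ solve 2 (λ s t → s := (s :- t) :+ t) refl s t ⟩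
    s - t + t  ≈⟨ +-congʳ s-t≈0 ⟩
    0# + t     ≈⟨ +-identityˡ t ⟩
    t          ∎)

  slope-* : ∀ g {s} → ¬ (s ≈ t) → slope g s * (s - t) ≈ g s - g t
  slope-* g s≉t = trans (*-assoc _ _ _) (trans (*-congˡ (*-inverseˡ _ (s-t≉0 s≉t))) (*-identityʳ _))

  -- Equality is asked on `I` alone because the closed form of `κ` is available only where the
  -- metric is positive.
  derivative-cong : ∀ {g h g′ h′} → I t → (∀ s → I s → g s ≈ h s) → g′ ≈ h′ →
                    HasDerivative I g t g′ → HasDerivative I h t h′
  derivative-cong It g≈h = lim-cong λ s Is _ → *-congʳ (+-cong (g≈h s Is) (-‿cong (g≈h t It)))

  derivative⇒continuous : ∀ {g g′} → HasDerivative I g t g′ → Lim g (g t)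
  derivative⇒continuous {g} {g′} dg = null⇒lim (lim-cong (λ s _ s≉t → slope-* g s≉t) (zeroʳ g′)
    (lim-* dg λ ε 0<ε → ε , 0<ε , λ s _ _ → near-cong (solve 2 (λ s t → s :- t := s :- t :- :0) refl s t)))

  derivative-const : ∀ c → HasDerivative I (λ _ → c) t 0#
  derivative-const c = lim-cong (λ s _ _ → sym (trans (*-congʳ (-‿inverseʳ c)) (zeroˡ _))) refl (lim-const 0#)

  derivative-+ : ∀ {g h g′ h′} → HasDerivative I g t g′ → HasDerivative I h t h′ →
                 HasDerivative I (λ s → g s + h s) t (g′ + h′)
  derivative-+ {g} {h} dg dh = lim-cong
    (λ s _ _ → solve 5 (λ a b c d v → (a :- b) :* v :+ (c :- d) :* v := (a :+ c :- (b :+ d)) :* v)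
                 refl (g s) (g t) (h s) (h t) ((s - t) ⁻¹))
    refl (lim-+ dg dh)

  derivative-* : ∀ {g h g′ h′} → HasDerivative I g t g′ → HasDerivative I h t h′ →
                 HasDerivative I (λ s → g s * h s) t (g′ * h t + g t * h′)
  derivative-* {g} {h} dg dh = lim-cong
    (λ s _ _ → solve 5 (λ a b c d v → (a :- b) :* v :* c :+ b :* ((c :- d) :* v) := (a :* c :- b :* d) :* v)
                 refl (g s) (g t) (h s) (h t) ((s - t) ⁻¹))
    refl (lim-+ (lim-* dg (derivative⇒continuous dh)) (lim-* (lim-const (g t)) dh))

  derivative-*ˡ : ∀ {g g′} c → HasDerivative I g t g′ → HasDerivative I (λ s → c * g s) t (c * g′)
  derivative-*ˡ {g} c dg = lim-cong
    (λ s _ _ → solve 4 (λ a b c v → c :* ((a :- b) :* v) := (c :* a :- c :* b) :* v)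
                 refl (g s) (g t) c ((s - t) ⁻¹))
    refl (lim-* (lim-const c) dg)

  derivative-⁻¹ : ∀ {g g′} → I t → (∀ s → I s → 0# < g s) → HasDerivative I g t g′ →
                  HasDerivative I (λ s → g s ⁻¹) t (- (g′ * (g t ⁻¹ * g t ⁻¹)))
  derivative-⁻¹ {g} {g′} It g>0 dg = lim-cong
    (λ s Is _ → begin
      slope g s * (g s ⁻¹ * - g t ⁻¹)
        ≈⟨ solve 5 (λ a b v i j → (a :- b) :* v :* (i :* (:- j)) := ((b :* j) :* i :- (a :* i) :* j) :* v)
             refl (g s) (g t) ((s - t) ⁻¹) (g s ⁻¹) (g t ⁻¹) ⟩
      (g t / g t * g s ⁻¹ - g s / g s * g t ⁻¹) / (s - t)
        ≈⟨ *-congʳ (+-cong (*-congʳ (*-inverseʳ _ (pos⇒≉0 (g>0 t It))))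
                           (-‿cong (*-congʳ (*-inverseʳ _ (pos⇒≉0 (g>0 s Is)))))) ⟩
      (1# * g s ⁻¹ - 1# * g t ⁻¹) / (s - t)
        ≈⟨ *-congʳ (+-cong (*-identityˡ _) (-‿cong (*-identityˡ _))) ⟩
      (g s ⁻¹ - g t ⁻¹) / (s - t)  ∎)
    (solve 2 (λ d j → d :* (j :* (:- j)) := :- (d :* (j :* j))) refl g′ (g t ⁻¹))
    (lim-* dg (lim-* (lim-⁻¹ (derivative⇒continuous dg) (g>0 t It) g>0) (lim-const (- g t ⁻¹))))

  derivative-when : ∀ {p} {P : Set p} (P? : Dec P) {g g′} → HasDerivative I g t g′ →
                    HasDerivative I (λ s → when P? (g s)) t (when P? g′)
  derivative-when (yes _) dg = dg
  derivative-when (no _)  _  = derivative-const 0#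

  derivative-∑ : ∀ {n} (g : Carrier → Vector Carrier n) {g′} →
                 (∀ i → HasDerivative I (λ s → g s i) t (g′ i)) →
                 HasDerivative I (λ s → sum (g s)) t (sum g′)
  derivative-∑ {zero}  g dg = derivative-const 0#
  derivative-∑ {suc n} g dg = derivative-+ (dg zero) (derivative-∑ (λ s → g s ∘ suc) (dg ∘ suc))

-- Edge coefficients and the Dirichlet form

module Coefficients {ℓ : Level} (ℝ : CompleteOrderedField ℓ) (T : Tree)
                    (w : Curvature.Weight ℝ T) (w>0 : Curvature.Positive ℝ T w) where
  open CompleteOrderedField ℝ
  open Tree T
  open Curvature ℝ T
  open OrderedField ℝ
  open LinearAlgebra ℝ
  open FiniteSums ℝ
  open GraphProperties graph
  open DegreeExcess ℝ graph
  open Transport ℝ T w w>0 using (D>0)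
  open import Relation.Binary.Reasoning.Setoid setoid

  D²ww>0 : ∀ {x e} f → x ∈ₑ e → 0# < D w x * D w x * w e * w f
  D²ww>0 {x} {e} f x∈e =
    *-positive (*-positive (*-positive (D>0 x∈e) (D>0 x∈e)) (w>0 e)) (w>0 f)

  a-nonneg : ∀ e f → 0# ≤ a w e f
  a-nonneg e f with shareVertex? e f
  ... | no _              = ≤-refl
  ... | yes (x , x∈e , _) = when-nonneg (3 ℕ.≤? degree x) λ 3≤d →
    *-nonneg (excess-nonneg (ℕ.<⇒≤ 3≤d)) (inj₁ (⁻¹-positive (D²ww>0 f x∈e)))

  a-disjoint : ∀ {e f} → ¬ ShareVertex e f → a w e f ≈ 0#
  a-disjoint {e} {f} disjoint with shareVertex? e f
  ... | no _       = refl
  ... | yes shares = contradiction shares disjoint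

  -- Two distinct edges at `x` force d_x ≥ 2. So if the test 3 ≤ d_x in `a` fails, then d_x = 2 and
  -- `excess x` is 0: one formula covers both branches.
  a-shared : ∀ {e f x} → e ≢ f → x ∈ₑ e → x ∈ₑ f →
             a w e f ≈ excess x * (w e ⁻¹ * w f ⁻¹ * (D w x ⁻¹ * D w x ⁻¹))
  a-shared {e} {f} {x} e≢f x∈e x∈f with shareVertex? e f
  ... | no disjoint = contradiction (x , x∈e , x∈f) disjoint
  ... | yes (y , y∈e , y∈f) with ≡.refl ← shared-unique e≢f x∈e x∈f y∈e y∈f =
    sym (≈-when (3 ℕ.≤? degree x)
      (λ _ → *-congˡ (begin
        w e ⁻¹ * w f ⁻¹ * (D w x ⁻¹ * D w x ⁻¹)
          ≈⟨ solve 3 (λ u v d → u :* v :* (d :* d) := d :* d :* u :* v) refl (w e ⁻¹) (w f ⁻¹) (D w x ⁻¹) ⟩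
        D w x ⁻¹ * D w x ⁻¹ * w e ⁻¹ * w f ⁻¹
          ≈⟨ *-congʳ (*-congʳ (⁻¹-distrib-* D≉0 D≉0)) ⟨
        (D w x * D w x) ⁻¹ * w e ⁻¹ * w f ⁻¹
          ≈⟨ *-congʳ (⁻¹-distrib-* (*-≉0 D≉0 D≉0) we≉0) ⟨
        (D w x * D w x * w e) ⁻¹ * w f ⁻¹
          ≈⟨ ⁻¹-distrib-* (*-≉0 (*-≉0 D≉0 D≉0) we≉0) (pos⇒≉0 (w>0 f)) ⟨
        (D w x * D w x * w e * w f) ⁻¹  ∎))
      (λ 3≰d → trans (*-congʳ (begin
        excess x          ≡⟨ ≡.cong (λ n → fromℕ n - fromℕ 2) (ℕ.≤-antisym (ℕ.≮⇒≥ 3≰d) (2≤degree e≢f x∈e x∈f)) ⟩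
        fromℕ 2 - fromℕ 2 ≈⟨ -‿inverseʳ (fromℕ 2) ⟩
        0#                ∎)) (zeroˡ _)))
    where
    D≉0 = pos⇒≉0 (D>0 x∈e)
    we≉0 = pos⇒≉0 (w>0 e)

  a-sym : ∀ {e f} → e ≢ f → a w e f ≈ a w f e
  a-sym {e} {f} e≢f = case (shareVertex? e f)
    where
    case : Dec (ShareVertex e f) → a w e f ≈ a w f e
    case (yes (x , x∈e , x∈f)) = trans (a-shared e≢f x∈e x∈f)
      (trans (*-congˡ (*-congʳ (*-comm _ _))) (sym (a-shared (e≢f ∘ ≡.sym) x∈f x∈e)))
    case (no disjoint) = trans (a-disjoint disjoint)
      (sym (a-disjoint λ (x , x∈f , x∈e) → disjoint (x , x∈e , x∈f)))

  𝓛-symmetric : Symmetric (𝓛 w)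
  𝓛-symmetric e f with f Fin.≟ e | e Fin.≟ f
  ... | yes ≡.refl | yes _   = refl
  ... | yes ≡.refl | no e≢e  = contradiction ≡.refl e≢e
  ... | no f≢f | yes ≡.refl  = contradiction ≡.refl f≢f
  ... | no _       | no e≢f  = -‿cong (a-sym e≢f)

  𝓛-𝟏 : ∀ e → (𝓛 w *ᵥ 𝟏) e ≈ 0#
  𝓛-𝟏 e = trans (𝓛-action w 𝟏 e) (∑-zero _ λ f → sym (≈-when (¬? (f Fin.≟ e))
    (λ _ → sym (trans (*-congˡ (-‿inverseʳ 1#)) (zeroʳ _))) (λ _ → refl)))

  private
    pairTerm : Vector Carrier ∣E∣ → Edge → Edge → Carrier
    pairTerm z e f = a w e f * ((z e - z f) * (z e - z f))

    pairTerm-nonneg : ∀ z e f → 0# ≤ pairTerm z e f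
    pairTerm-nonneg z e f = *-nonneg (a-nonneg e f) (square-nonneg (z e - z f))

  dirichletForm-nonneg : ∀ z → 0# ≤ dirichletForm w z
  dirichletForm-nonneg z = ∑-nonneg _ λ e → ∑-nonneg _ λ f →
    when-nonneg ((e Fin.<? f) ×-dec (0# <? a w e f)) λ _ → pairTerm-nonneg z e f

  -- The terms of (e, f) and (f, e) add up to a_ef (z_e (z_e - z_f) + z_f (z_f - z_e)), which is
  -- a_ef (z_e - z_f)².
  quadratic≈dirichlet : ∀ z → ⟨ z , 𝓛 w *ᵥ z ⟩ ≈ dirichletForm w z
  quadratic≈dirichlet z = begin
    ⟨ z , 𝓛 w *ᵥ z ⟩
      ≈⟨ sum-cong-≋ (λ e → trans (*-congˡ (𝓛-action w z e))
           (*-distribˡ-sum (z e) (λ f → when (¬? (f Fin.≟ e)) (a w e f * (z e - z f))))) ⟩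
    ∑[ e < ∣E∣ ] ∑[ f < ∣E∣ ] G e f
      ≈⟨ ∑∑-pairs G (λ e → trans (*-congˡ (when-no (¬? (e Fin.≟ e)) λ e≢e → e≢e ≡.refl)) (zeroʳ (z e))) ⟩
    ∑[ e < ∣E∣ ] ∑[ f < ∣E∣ ] when (e Fin.<? f) (G e f + G f e)
      ≈⟨ sum-cong-≋ (λ e → sum-cong-≋ λ f → pair e f) ⟩
    dirichletForm w z  ∎
    where
    G : Edge → Edge → Carrier
    G e f = z e * when (¬? (f Fin.≟ e)) (a w e f * (z e - z f))

    symmetrize : ∀ {e f} → e ≢ f → G e f + G f e ≈ pairTerm z e f
    symmetrize {e} {f} e≢f = begin
      G e f + G f e
        ≈⟨ +-cong (*-congˡ (when-yes (¬? (f Fin.≟ e)) (e≢f ∘ ≡.sym)))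
                  (*-congˡ (trans (when-yes (¬? (e Fin.≟ f)) e≢f) (*-congʳ (sym (a-sym e≢f))))) ⟩
      z e * (a w e f * (z e - z f)) + z f * (a w e f * (z f - z e))
        ≈⟨ solve 3 (λ c p q → p :* (c :* (p :- q)) :+ q :* (c :* (q :- p)) := c :* ((p :- q) :* (p :- q)))
             refl (a w e f) (z e) (z f) ⟩
      pairTerm z e f  ∎

    pair : ∀ e f → when (e Fin.<? f) (G e f + G f e) ≈
                   when ((e Fin.<? f) ×-dec (0# <? a w e f)) (pairTerm z e f)
    pair e f = ≈-when ((e Fin.<? f) ×-dec (0# <? a w e f))
      (λ (e<f , _) → trans (when-yes (e Fin.<? f) e<f) (symmetrize (Fin.<⇒≢ e<f)))
      -- A pair e < f left out of the Dirichlet form has coefficient 0, being nonnegative and not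
      -- positive.
      (λ not → sym (≈-when (e Fin.<? f)
        (λ e<f → sym (trans (symmetrize (Fin.<⇒≢ e<f))
          (trans (*-congʳ (≤-antisym (≮⇒≥ λ 0<a → not (e<f , 0<a)) (a-nonneg e f))) (zeroˡ _))))
        (λ _ → refl)))

  𝓛-semidefinite : PositiveSemidefinite (𝓛 w)
  𝓛-semidefinite z = ≤-respʳ (sym (quadratic≈dirichlet z)) (dirichletForm-nonneg z)

  private
    -- At z = κ w this is the derivative of excess x * (w e ⁻¹ / D w x) along
    -- either flow.
    vertexTerm : Vector Carrier ∣E∣ → Edge → Vertex → Carrier
    vertexTerm z e x = excess x * (w e ⁻¹ * (D w x ⁻¹ * D w x ⁻¹) *
                         ∑[ g < ∣E∣ ] when (x ∈ₑ? g) (w g ⁻¹ * (z e - z g)))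

  -- An edge other than `e` meets at most one end of `e`, so splitting by ends counts nothing twice.
  -- Each vertex sum also contains `g = e`, with the factor `z e - z e`; at a leaf this is its only
  -- term.
  𝓛-vertexwise : ∀ z e → (𝓛 w *ᵥ z) e ≈ vertexTerm z e (lo e) + vertexTerm z e (hi e)
  𝓛-vertexwise z e = begin
    (𝓛 w *ᵥ z) e
      ≈⟨ 𝓛-action w z e ⟩
    ∑[ g < ∣E∣ ] when (¬? (g Fin.≟ e)) (a w e g * (z e - z g))
      ≈⟨ sum-cong-≋ (λ g → edgeTerm g (g Fin.≟ e) (lo e ∈ₑ? g) (hi e ∈ₑ? g)) ⟩
    ∑[ g < ∣E∣ ] (c (lo e) * when (lo e ∈ₑ? g) (w g ⁻¹ * (z e - z g)) + c (hi e) * when (hi e ∈ₑ? g) (w g ⁻¹ * (z e - z g)))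
      ≈⟨ ∑-distrib-+ (λ g → c (lo e) * when (lo e ∈ₑ? g) (w g ⁻¹ * (z e - z g)))
                     (λ g → c (hi e) * when (hi e ∈ₑ? g) (w g ⁻¹ * (z e - z g))) ⟩
    ∑[ g < ∣E∣ ] (c (lo e) * when (lo e ∈ₑ? g) (w g ⁻¹ * (z e - z g))) +
    ∑[ g < ∣E∣ ] (c (hi e) * when (hi e ∈ₑ? g) (w g ⁻¹ * (z e - z g)))
      ≈⟨ +-cong (factor (lo e)) (factor (hi e)) ⟩
    vertexTerm z e (lo e) + vertexTerm z e (hi e)  ∎
    where
    c : Vertex → Carrier
    c x = excess x * (w e ⁻¹ * (D w x ⁻¹ * D w x ⁻¹))

    factor : ∀ x → ∑[ g < ∣E∣ ] (c x * when (x ∈ₑ? g) (w g ⁻¹ * (z e - z g))) ≈ vertexTerm z e x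
    factor x = trans (sym (*-distribˡ-sum (c x) (λ g → when (x ∈ₑ? g) (w g ⁻¹ * (z e - z g))))) (*-assoc _ _ _)

    shared : ∀ {x g} → e ≢ g → x ∈ₑ e → x ∈ₑ g → a w e g * (z e - z g) ≈ c x * (w g ⁻¹ * (z e - z g))
    shared {x} {g} e≢g x∈e x∈g = trans (*-congʳ (a-shared e≢g x∈e x∈g))
      (solve 5 (λ b u v k y → b :* (u :* v :* k) :* y := b :* (u :* k) :* (v :* y)) refl
        (excess x) (w e ⁻¹) (w g ⁻¹) (D w x ⁻¹ * D w x ⁻¹) (z e - z g))

    edgeTerm : ∀ g (g≟e : Dec (g ≡ e)) (lo∈? : Dec (lo e ∈ₑ g)) (hi∈? : Dec (hi e ∈ₑ g)) →
      when (¬? g≟e) (a w e g * (z e - z g)) ≈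
      c (lo e) * when lo∈? (w g ⁻¹ * (z e - z g)) + c (hi e) * when hi∈? (w g ⁻¹ * (z e - z g))
    edgeTerm g (yes ≡.refl) lo∈? hi∈? = sym (trans (+-cong (vanish lo∈?) (vanish hi∈?)) (+-identityˡ _))
      where
      vanish : ∀ {P : Set} (P? : Dec P) {b} → b * when P? (w e ⁻¹ * (z e - z e)) ≈ 0#
      vanish (no _)      = zeroʳ _
      vanish (yes _) {b} = solve 3 (λ b u y → b :* (u :* (y :- y)) := :0) refl b (w e ⁻¹) (z e)
    edgeTerm g (no g≢e) (yes lo∈) (yes hi∈) =
      contradiction (shared-unique (g≢e ∘ ≡.sym) (inj₁ ≡.refl) lo∈ (inj₂ ≡.refl) hi∈) (lo≢hi e)
    edgeTerm g (no g≢e) (yes lo∈) (no hi∉) = trans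
      (shared (g≢e ∘ ≡.sym) (inj₁ ≡.refl) lo∈) (sym (trans (+-congˡ (zeroʳ _)) (+-identityʳ _)))
    edgeTerm g (no g≢e) (no lo∉) (yes hi∈) = trans
      (shared (g≢e ∘ ≡.sym) (inj₂ ≡.refl) hi∈) (sym (trans (+-congʳ (zeroʳ _)) (+-identityˡ _)))
    edgeTerm g (no g≢e) (no lo∉) (no hi∉) = trans
      (*-congʳ (a-disjoint λ where
        (_ , inj₁ ≡.refl , lo∈) → lo∉ lo∈
        (_ , inj₂ ≡.refl , hi∈) → hi∉ hi∈))
      (trans (zeroˡ _) (sym (trans (+-cong (zeroʳ _) (zeroʳ _)) (+-identityˡ _))))

-- Evolution of the curvature along both flows

module Flow {ℓ : Level} (ℝ : CompleteOrderedField ℓ) (T : Tree)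
            (I : Pred (CompleteOrderedField.Carrier ℝ) ℓ)
            (w : CompleteOrderedField.Carrier ℝ → Curvature.Weight ℝ T)
            (w>0 : ∀ s → I s → Curvature.Positive ℝ T (w s))
            (t : CompleteOrderedField.Carrier ℝ) (It : I t) where
  open CompleteOrderedField ℝ
  open Tree T
  open Curvature ℝ T
  open OrderedField ℝ
  open LinearAlgebra ℝ
  open FiniteSums ℝ
  open Analysis ℝ
  open Calculus ℝ I t
  open import Relation.Binary.Reasoning.Setoid setoid
  open DegreeExcess ℝ graph
  open Transport ℝ T (w t) (w>0 t It) using (D>0)
  open Coefficients ℝ T (w t) (w>0 t It) using (𝓛-vertexwise)

  -- The unnormalized flow has c = 0#, the normalized one c = K (w t).
  module _ (c : Carrier)
           (flow : ∀ e → HasDerivative I (λ s → w s e) t (- (w t e * (κ (w t) e - c)))) where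
    private
      u : Edge → Carrier
      u e = w t e ⁻¹

      k : Edge → Carrier
      k e = κ (w t) e

    derivative-w⁻¹ : ∀ e → HasDerivative I (λ s → w s e ⁻¹) t (u e * (k e - c))
    derivative-w⁻¹ e = derivative-cong It (λ _ _ → refl)
      (begin
        - (- (w t e * (k e - c)) * (u e * u e))
          ≈⟨ solve 3 (λ w y u → :- ((:- (w :* y)) :* (u :* u)) := w :* u :* (u :* y)) refl (w t e) (k e - c) (u e) ⟩
        w t e / w t e * (u e * (k e - c))
          ≈⟨ *-congʳ (*-inverseʳ _ (pos⇒≉0 (w>0 t It e))) ⟩
        1# * (u e * (k e - c))
          ≈⟨ *-identityˡ _ ⟩
        u e * (k e - c)  ∎)
      (derivative-⁻¹ It (λ s Is → w>0 s Is e) (flow e))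

    derivative-D : ∀ x → HasDerivative I (λ s → D (w s) x) t (∑[ g < ∣E∣ ] when (x ∈ₑ? g) (u g * (k g - c)))
    derivative-D x = derivative-∑ (λ s g → when (x ∈ₑ? g) (w s g ⁻¹))
      (λ g → derivative-when (x ∈ₑ? g) (derivative-w⁻¹ g))

    derivative-w⁻¹/D : ∀ {e x} → x ∈ₑ e →
      HasDerivative I (λ s → w s e ⁻¹ / D (w s) x) t
        (u e * (D (w t) x ⁻¹ * D (w t) x ⁻¹) * ∑[ g < ∣E∣ ] when (x ∈ₑ? g) (u g * (k e - k g)))
    derivative-w⁻¹/D {e} {x} x∈e = derivative-cong It (λ _ _ → refl)
      (begin
        u e * (k e - c) * i + u e * - (D′ * (i * i))
          ≈⟨ solve 4 (λ u y i d → u :* y :* i :+ u :* (:- (d :* (i :* i))) := u :* (y :* (:1 :* i) :- i :* i :* d))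
               refl (u e) (k e - c) i D′ ⟩
        u e * ((k e - c) * (1# * i) - i * i * D′)
          -- D_x · D_x⁻¹ is inserted to give both summands the factor D_x⁻². Then (κ_e - c) D_x and
          -- the derivative of D_x are sums over the same edges, and c drops out term by term.
          ≈⟨ *-congˡ (+-congʳ (*-congˡ (*-congʳ (*-inverseʳ _ (pos⇒≉0 (D>0 x∈e)))))) ⟨
        u e * ((k e - c) * (D (w t) x * i * i) - i * i * D′)
          ≈⟨ solve 5 (λ u y d i d′ → u :* (y :* (d :* i :* i) :- i :* i :* d′) := u :* (i :* i) :* (y :* d :- d′))
               refl (u e) (k e - c) (D (w t) x) i D′ ⟩
        u e * (i * i) * ((k e - c) * D (w t) x - D′)
          ≈⟨ *-congˡ (trans (+-congʳ (*-distribˡ-sum (k e - c) (λ g → when (x ∈ₑ? g) (u g))))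
               (sym (∑-distrib-‿- (λ g → (k e - c) * when (x ∈ₑ? g) (u g)) (λ g → when (x ∈ₑ? g) (u g * (k g - c)))))) ⟩
        u e * (i * i) * ∑[ g < ∣E∣ ] ((k e - c) * when (x ∈ₑ? g) (u g) - when (x ∈ₑ? g) (u g * (k g - c)))
          ≈⟨ *-congˡ (sum-cong-≋ λ g → difference (x ∈ₑ? g) g) ⟩
        u e * (i * i) * ∑[ g < ∣E∣ ] when (x ∈ₑ? g) (u g * (k e - k g))  ∎)
      (derivative-* (derivative-w⁻¹ e) (derivative-⁻¹-D))
      where
      i D′ : Carrier
      i = D (w t) x ⁻¹
      D′ = ∑[ g < ∣E∣ ] when (x ∈ₑ? g) (u g * (k g - c))

      derivative-⁻¹-D : HasDerivative I (λ s → D (w s) x ⁻¹) t (- (D′ * (i * i)))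
      derivative-⁻¹-D = derivative-⁻¹ It (λ s Is → Transport.D>0 ℝ T (w s) (w>0 s Is) x∈e) (derivative-D x)

      difference : ∀ {P : Set} (P? : Dec P) g →
        (k e - c) * when P? (u g) - when P? (u g * (k g - c)) ≈ when P? (u g * (k e - k g))
      difference (yes _) g = solve 4 (λ p q c v → (p :- c) :* v :- v :* (q :- c) := v :* (p :- q))
                               refl (k e) (k g) c (u g)
      difference (no _)  g = trans (+-congʳ (zeroʳ _)) (-‿inverseʳ 0#)

    derivative-κ : ∀ e → HasDerivative I (λ s → κ (w s) e) t (- (𝓛 (w t) *ᵥ κ (w t)) e)
    derivative-κ e = derivative-cong It
      (λ s Is → begin
        -- Multiplication by -1 in place of negation lets `derivative-*ˡ` take care of the sign.
        - 1# * (excess (lo e) * (w s e ⁻¹ / D (w s) (lo e)) + excess (hi e) * (w s e ⁻¹ / D (w s) (hi e)))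
          ≈⟨ solve 5 (λ u a b i j → (:- :1) :* (a :* (u :* i) :+ b :* (u :* j)) := :- (u :* (a :* i :+ b :* j)))
               refl (w s e ⁻¹) (excess (lo e)) (excess (hi e)) (D (w s) (lo e) ⁻¹) (D (w s) (hi e) ⁻¹) ⟩
        - (w s e ⁻¹ * (excess (lo e) / D (w s) (lo e) + excess (hi e) / D (w s) (hi e)))
          ≈⟨ LinLuYau.κ-formula ℝ T (w s) (w>0 s Is) e ⟨
        κ (w s) e  ∎)
      (trans (solve 1 (λ x → (:- :1) :* x := :- x) refl _) (-‿cong (sym (𝓛-vertexwise (κ (w t)) e))))
      (derivative-*ˡ (- 1#) (derivative-+
        (derivative-*ˡ (excess (lo e)) (derivative-w⁻¹/D (inj₁ ≡.refl)))
        (derivative-*ˡ (excess (hi e)) (derivative-w⁻¹/D (inj₂ ≡.refl)))))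

theorem1p1 : {ℓ : Level} (ℝ : CompleteOrderedField ℓ) (T : Tree) →
    let open CompleteOrderedField ℝ
        open Analysis ℝ
        open LinearAlgebra ℝ
        open Tree T
        open Curvature ℝ T
    in
    NonZero ∣E∣ →
    ((I : Pred Carrier ℓ) → IsInterval I → (w : Carrier → Weight) →
      UnnormalizedFlow I w ⊎ NormalizedFlow I w →
      ∀ t → I t → ∀ e → HasDerivative I (λ s → κ (w s) e) t (- (𝓛 (w t) *ᵥ κ (w t)) e))
    ×
    ((w : Weight) → Positive w →
      Symmetric (𝓛 w) ×
      PositiveSemidefinite (𝓛 w) ×
      (∀ e → (𝓛 w *ᵥ 𝟏) e ≈ 0#) ×
      ((z : Vector Carrier ∣E∣) →
        ⟨ z , 𝓛 w *ᵥ z ⟩ ≈ dirichletForm w z × 0# ≤ dirichletForm w z))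
theorem1p1 ℝ T _ = evolution , λ w w>0 → let open Coefficients ℝ T w w>0 in
  𝓛-symmetric , 𝓛-semidefinite , 𝓛-𝟏 , λ z → quadratic≈dirichlet z , dirichletForm-nonneg z
  where
  open CompleteOrderedField ℝ
  open OrderedField ℝ
  open Analysis ℝ
  open LinearAlgebra ℝ
  open Tree T
  open Curvature ℝ T

  evolution : ∀ I → IsInterval I → ∀ w → UnnormalizedFlow I w ⊎ NormalizedFlow I w →
    ∀ t → I t → ∀ e → HasDerivative I (λ s → κ (w s) e) t (- (𝓛 (w t) *ᵥ κ (w t)) e)
  evolution I _ w (inj₁ flow) t It = derivative-κ 0# λ e → derivative-cong It (λ _ _ → refl)
    (solve 2 (λ k v → (:- k) :* v := :- (v :* (k :- :0))) refl (κ (w t) e) (w t e)) (solves t It e)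
    where
    open IsPositiveSolution flow
    open Flow ℝ T I w positive t It
    open Calculus ℝ I t
  evolution I _ w (inj₂ (flow , _)) t It = derivative-κ (K (w t)) (solves t It)
    where
    open IsPositiveSolution flow
    open Flow ℝ T I w positive t It
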